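{- Let $H$ be Hall's universal group. (a) Let $G$ be a finite group such that $D_{2m} \le G$ for some positive integer $m$. Then $T(G,H) = \infty$. (b) Let $G$ be a finite group. If $C_2 \times C_2 \le G$, then $T(G,H) = \infty$. (c) If $A = C_{n_1} \times \dots \times C_{n_k}$ is a finite abelian group such that at least two of the integers $n_1,\dots,n_k$ are even, then $T(A,H) = \infty$. (d) $T(S_n, H) = \infty$ for all $n \ge 3$, where $S_n$ denotes the symmetric group.
   Context: Hall's universal group $H$ is the Fraïssé limit of the class of all finite groups: the (unique up to isomorphism) countable locally finite group that embeds every finite group and in which every isomorphism between two finite subgroups extends to an automorphism of $H$. For a positive integer $n$, $D_n$ denotes the dihedral group with $2n$ elements (so $D_{2m}$ has $4m$ elements, and $D_2 \cong C_2 \times C_2$), and $C_n$ denotes the cyclic group of order $n$. For groups, $K \le G$ means that $G$ has a subgroup isomorphic to $K$. For first-order structures $A, B$ of the same signature, $\mathrm{Emb}(A,B)$ denotes the set of all embeddings $A \hookrightarrow B$ (for groups: injective homomorphisms). Let $A$ be a finite structure and $S$ a locally finite structure. The big Ramsey degree $T(A,S)$ of $A$ in $S$ is the least positive integer $n$, if it exists, such that for every positive integer $k$ and every coloring $\chi : \mathrm{Emb}(A,S) \to \{0,\dots,k-1\}$ there is $w \in \mathrm{Emb}(S,S)$ with $|\chi(w \circ \mathrm{Emb}(A,S))| \le n$, where $w \circ \mathrm{Emb}(A,S) = \{w \circ f : f \in \mathrm{Emb}(A,S)\}$. If no such $n$ exists, write $T(A,S) = \infty$. -}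

module Defs where

open import Algebra.Bundles using (Group)
open import Algebra.Construct.DirectProduct as DirectProduct using ()
open import Algebra.Construct.Terminal as Terminal using ()
open import Algebra.Morphism.Construct.Composition using (isGroupMonomorphism)
open import Algebra.Morphism.Structures using (module GroupMorphisms)
open import Data.Fin.Base using (Fin)
open import Data.Fin.Permutation as Perm using (Permutation′; _⟨$⟩ʳ_; _⟨$⟩ˡ_; _∘ₚ_)
open import Data.Fin.Subset using (Subset; _∈_; ∣_∣)
open import Data.Integer.Base as ℤ using (ℤ; +_)
open import Data.Integer.Divisibility.Signed
  using (_∣_; divides; ∣m∣n⇒∣m+n; ∣m⇒∣-m)
open import Data.Integer.Properties as ℤₚ using ()
open import Data.Integer.Tactic.RingSolver using (solve-∀)
open import Data.List.Base using (List)
open import Data.List.Membership.Propositional using () renaming (_∈_ to _∈ₗ_)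
open import Data.Nat.Base using (ℕ; _≤_)
open import Data.Product.Base using (Σ; Σ-syntax; ∃-syntax; _×_; _,_; proj₁; proj₂)
open import Data.Sign.Base as Sign using (Sign)
open import Data.Sign.Properties as Signₚ using ()
open import Data.Vec.Base using (Vec; []; _∷_)
open import Function.Base using (_∘_)
open import Function.Bundles using (Func; Inverse)
open import Level using (0ℓ)
open import Relation.Binary.Bundles using (Setoid)
open import Relation.Binary.PropositionalEquality as ≡
  using (_≡_; refl; sym; trans; cong; subst)
open import Relation.Nullary.Negation using (¬_)
open import Relation.Unary using (Pred)

open Group using (Carrier; setoid; rawGroup)

-- Groups are setoid-based, so every function on elements, and every coloring
-- of embeddings, is required to respect the relevant equality.
Grp : Set₁
Grp = Group 0ℓ 0ℓ

IsFinite : Grp → Set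
IsFinite G = ∃[ n ] Inverse (setoid G) (≡.setoid (Fin n))

IsCountablyInfinite : Grp → Set
IsCountablyInfinite G = Inverse (setoid G) (≡.setoid ℕ)

IsEmbedding IsIso : (A B : Grp) → (Carrier A → Carrier B) → Set
IsEmbedding A B = GroupMorphisms.IsGroupMonomorphism (rawGroup A) (rawGroup B)
IsIso       A B = GroupMorphisms.IsGroupIsomorphism  (rawGroup A) (rawGroup B)

record Emb (A B : Grp) : Set where
  field
    to          : Carrier A → Carrier B
    isEmbedding : IsEmbedding A B to

infix 4 _≅_
record _≅_ (A B : Grp) : Set where
  field
    to    : Carrier A → Carrier B
    isIso : IsIso A B to

infixr 9 _∘ₑ_
_∘ₑ_ : {A B C : Grp} → Emb B C → Emb A B → Emb A C
_∘ₑ_ {C = C} g f = record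
  { to          = Emb.to g ∘ Emb.to f
  ; isEmbedding = isGroupMonomorphism (Group.trans C)
                    (Emb.isEmbedding f) (Emb.isEmbedding g)
  }

EmbSetoid : Grp → Grp → Setoid 0ℓ 0ℓ
EmbSetoid A B = record
  { Carrier       = Emb A B
  ; _≈_           = λ f g → ∀ x → Emb.to f x ≈ Emb.to g x
  ; isEquivalence = record
    { refl  = λ _ → Group.refl B
    ; sym   = λ p x → Group.sym B (p x)
    ; trans = λ p q x → Group.trans B (p x) (q x)
    }
  }
  where open Group B using (_≈_)

record Subgroup (G : Grp) : Set₁ where
  open Group G using (_≈_; _∙_; ε; _⁻¹)
  field
    Member    : Pred (Carrier G) 0ℓ
    resp      : ∀ {x y} → x ≈ y → Member x → Member y
    ε-closed  : Member ε
    ∙-closed  : ∀ {x y} → Member x → Member y → Member (x ∙ y)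
    ⁻¹-closed : ∀ {x} → Member x → Member (x ⁻¹)

-- Elements are compared in G, irrespective of their membership proofs.
toGroup : {G : Grp} → Subgroup G → Grp
toGroup {G} P = record
  { Carrier = Σ (Carrier G) P.Member
  ; _≈_     = λ x y → proj₁ x G.≈ proj₁ y
  ; _∙_     = λ { (x , p) (y , q) → x G.∙ y , P.∙-closed p q }
  ; ε       = G.ε , P.ε-closed
  ; _⁻¹     = λ { (x , p) → x G.⁻¹ , P.⁻¹-closed p }
  ; isGroup = record
    { isMonoid = record
      { isSemigroup = record
        { isMagma = record
          { isEquivalence = record
            { refl = G.refl ; sym = G.sym ; trans = G.trans }
          ; ∙-cong = G.∙-cong
          }
        ; assoc = λ x y z → G.assoc (proj₁ x) (proj₁ y) (proj₁ z)
        }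
      ; identity = (λ x → G.identityˡ (proj₁ x)) , (λ x → G.identityʳ (proj₁ x))
      }
    ; inverse = (λ x → G.inverseˡ (proj₁ x)) , (λ x → G.inverseʳ (proj₁ x))
    ; ⁻¹-cong = G.⁻¹-cong
    }
  }
  where
  module G = Group G
  module P = Subgroup P

infix 4 _≲_
_≲_ : Grp → Grp → Set₁
K ≲ G = Σ[ P ∈ Subgroup G ] K ≅ toGroup P

data Generated (G : Grp) (xs : List (Carrier G)) : Pred (Carrier G) 0ℓ where
  gen  : ∀ {x} → x ∈ₗ xs → Generated G xs x
  resp : ∀ {x y} → Group._≈_ G x y → Generated G xs x → Generated G xs y
  unit : Generated G xs (Group.ε G)
  mul  : ∀ {x y} → Generated G xs x → Generated G xs y →
         Generated G xs (Group._∙_ G x y)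
  inv  : ∀ {x} → Generated G xs x → Generated G xs (Group._⁻¹ G x)

⟨_⟩ : {G : Grp} → List (Carrier G) → Subgroup G
⟨_⟩ {G} xs = record
  { Member    = Generated G xs
  ; resp      = resp
  ; ε-closed  = unit
  ; ∙-closed  = mul
  ; ⁻¹-closed = inv
  }

IsLocallyFinite : Grp → Set
IsLocallyFinite G = (xs : List (Carrier G)) → IsFinite (toGroup (⟨_⟩ {G} xs))

-- These properties determine H up to isomorphism.  A countable group embedding
-- every finite group is infinite, so countability is given as a bijection with ℕ.
record IsHallUniversal (H : Grp) : Set₁ where
  open Group H using (_≈_)
  field
    countable     : IsCountablyInfinite H
    locallyFinite : IsLocallyFinite H
    universal     : (G : Grp) → IsFinite G → Emb G H
    homogeneous   : (P Q : Subgroup H) →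
                    IsFinite (toGroup P) → IsFinite (toGroup Q) →
                    (φ : toGroup P ≅ toGroup Q) →
                    Σ[ α ∈ H ≅ H ]
                      (∀ x → _≅_.to α (proj₁ x) ≈ proj₁ (_≅_.to φ x))

-- χ takes at most n values on w ∘ Emb(A,S): they all lie in a subset of
-- Fin k with at most n elements.
AtMostColors : {A S : Grp} {k : ℕ} → ℕ →
               Func (EmbSetoid A S) (≡.setoid (Fin k)) → Emb S S → Set
AtMostColors {A} {S} {k} n χ w =
  Σ[ C ∈ Subset k ] ∣ C ∣ ≤ n × ((f : Emb A S) → Func.to χ (w ∘ₑ f) ∈ C)

-- T(A,S) is the least positive n with this property, and ∞ if there is none.
RamseyBound : Grp → Grp → ℕ → Set
RamseyBound A S n =
  (k : ℕ) → 1 ≤ k → (χ : Func (EmbSetoid A S) (≡.setoid (Fin k))) →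
  Σ[ w ∈ Emb S S ] AtMostColors n χ w

T[_,_]≡∞ : Grp → Grp → Set
T[ A , S ]≡∞ = ¬ (∃[ n ] 1 ≤ n × RamseyBound A S n)

infix 4 _≡_[mod_]
_≡_[mod_] : ℤ → ℤ → ℕ → Set
i ≡ j [mod n ] = + n ∣ i ℤ.- j

module Mod (n : ℕ) where
  ≡⇒ : ∀ {i j} → i ≡ j → i ≡ j [mod n ]
  ≡⇒ {i} refl = divides (+ 0) (ℤₚ.+-inverseʳ i)

  mod-sym : ∀ {i j} → i ≡ j [mod n ] → j ≡ i [mod n ]
  mod-sym {i} {j} p = subst (+ n ∣_) (lemma i j) (∣m⇒∣-m p)
    where
    lemma : ∀ i j → ℤ.- (i ℤ.- j) ≡ j ℤ.- i
    lemma = solve-∀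

  mod-trans : ∀ {i j k} → i ≡ j [mod n ] → j ≡ k [mod n ] → i ≡ k [mod n ]
  mod-trans {i} {j} {k} p q = subst (+ n ∣_) (lemma i j k) (∣m∣n⇒∣m+n p q)
    where
    lemma : ∀ i j k → (i ℤ.- j) ℤ.+ (j ℤ.- k) ≡ i ℤ.- k
    lemma = solve-∀

  +-cong : ∀ {i j k l} → i ≡ j [mod n ] → k ≡ l [mod n ] →
           i ℤ.+ k ≡ j ℤ.+ l [mod n ]
  +-cong {i} {j} {k} {l} p q = subst (+ n ∣_) (lemma i j k l) (∣m∣n⇒∣m+n p q)
    where
    lemma : ∀ i j k l → (i ℤ.- j) ℤ.+ (k ℤ.- l) ≡ (i ℤ.+ k) ℤ.- (j ℤ.+ l)
    lemma = solve-∀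

  neg-cong : ∀ {i j} → i ≡ j [mod n ] → ℤ.- i ≡ ℤ.- j [mod n ]
  neg-cong {i} {j} p = subst (+ n ∣_) (lemma i j) (∣m⇒∣-m p)
    where
    lemma : ∀ i j → ℤ.- (i ℤ.- j) ≡ (ℤ.- i) ℤ.- (ℤ.- j)
    lemma = solve-∀

-- ℤ/nℤ, which is the cyclic group of order n when n is positive.
C : ℕ → Grp
C n = record
  { Carrier = ℤ
  ; _≈_     = _≡_[mod n ]
  ; _∙_     = ℤ._+_
  ; ε       = + 0
  ; _⁻¹     = ℤ.-_
  ; isGroup = record
    { isMonoid = record
      { isSemigroup = record
        { isMagma = record
          { isEquivalence = record
            { refl  = λ {i} → ≡⇒ {i} refl
            ; sym   = λ {i} {j} → mod-sym {i} {j}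
            ; trans = λ {i} {j} {k} → mod-trans {i} {j} {k}
            }
          ; ∙-cong = λ {i} {j} {k} {l} → +-cong {i} {j} {k} {l}
          }
        ; assoc = λ i j k → ≡⇒ (ℤₚ.+-assoc i j k)
        }
      ; identity = (λ i → ≡⇒ (ℤₚ.+-identityˡ i)) , (λ i → ≡⇒ (ℤₚ.+-identityʳ i))
      }
    ; inverse = (λ i → ≡⇒ (ℤₚ.+-inverseˡ i)) , (λ i → ≡⇒ (ℤₚ.+-inverseʳ i))
    ; ⁻¹-cong = λ {i} {j} → neg-cong {i} {j}
    }
  }
  where open Mod n

infixr 7 _·_
_·_ : Sign → ℤ → ℤ
Sign.+ · i = i
Sign.- · i = ℤ.- i

·-assoc : ∀ s t i → (s Sign.* t) · i ≡ s · (t · i)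
·-assoc Sign.+ t      i = refl
·-assoc Sign.- Sign.+ i = refl
·-assoc Sign.- Sign.- i = sym (ℤₚ.neg-involutive i)

·-distrib : ∀ s i j → s · (i ℤ.+ j) ≡ s · i ℤ.+ s · j
·-distrib Sign.+ i j = refl
·-distrib Sign.- i j = ℤₚ.neg-distrib-+ i j

·-zero : ∀ s → s · + 0 ≡ + 0
·-zero Sign.+ = refl
·-zero Sign.- = refl

·-neg : ∀ s i → s · (ℤ.- i) ≡ ℤ.- (s · i)
·-neg Sign.+ i = refl
·-neg Sign.- i = refl

-- The semidirect product of ℤ/nℤ by {±1} acting by negation: (i , s) stands
-- for the rotation rⁱ if s = +, and for the reflection rⁱσ if s = -, where
-- rⁿ = σ² = 1 and σrσ = r⁻¹.  For positive n this has 2n elements, and D 2 is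
-- the Klein four-group.
D : ℕ → Grp
D n = record
  { Carrier = ℤ × Sign
  ; _≈_     = λ { (i , s) (j , t) → i ≡ j [mod n ] × s ≡ t }
  ; _∙_     = λ { (i , s) (j , t) → i ℤ.+ s · j , s Sign.* t }
  ; ε       = + 0 , Sign.+
  ; _⁻¹     = λ { (i , s) → ℤ.- (s · i) , s }
  ; isGroup = record
    { isMonoid = record
      { isSemigroup = record
        { isMagma = record
          { isEquivalence = record
            { refl  = λ { {i , _} → ≡⇒ {i} refl , refl }
            ; sym   = λ { {i , _} {j , _} (p , q) → mod-sym {i} {j} p , sym q }
            ; trans = λ { {i , _} {j , _} {k , _} (p , q) (p′ , q′) →
                          mod-trans {i} {j} {k} p p′ , trans q q′ }
            }
          ; ∙-cong = λ { {i , s} {j , _} {k , _} {l , _} (p , refl) (q , q′) →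
                         +-cong {i} {j} {s · k} {s · l} p (·-cong s {k} {l} q)
                         , cong (Sign._*_ s) q′ }
          }
        ; assoc = λ { (i , s) (j , t) (k , u) →
                      ≡⇒ (trans (ℤₚ.+-assoc i (s · j) _)
                           (cong (ℤ._+_ i)
                             (trans (cong (ℤ._+_ (s · j)) (·-assoc s t k))
                                    (sym (·-distrib s j (t · k))))))
                      , Signₚ.*-assoc s t u }
        }
      ; identity = (λ { (i , s) → ≡⇒ (ℤₚ.+-identityˡ i) , refl })
                 , (λ { (i , s) →
                        ≡⇒ (trans (cong (ℤ._+_ i) (·-zero s)) (ℤₚ.+-identityʳ i))
                        , Signₚ.*-identityʳ s })
      }
    ; inverse = (λ { (i , s) → ≡⇒ (ℤₚ.+-inverseˡ (s · i)) , Signₚ.s*s≡+ s })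
              , (λ { (i , s) →
                     ≡⇒ (trans (cong (ℤ._+_ i) (right s i)) (ℤₚ.+-inverseʳ i))
                     , Signₚ.s*s≡+ s })
    ; ⁻¹-cong = λ { {i , s} {j , _} (p , refl) →
                    neg-cong {s · i} {s · j} (·-cong s {i} {j} p) , refl }
    }
  }
  where
  open Mod n

  ·-cong : ∀ s {i j} → i ≡ j [mod n ] → s · i ≡ s · j [mod n ]
  ·-cong Sign.+         p = p
  ·-cong Sign.- {i} {j} p = neg-cong {i} {j} p

  right : ∀ s i → s · (ℤ.- (s · i)) ≡ ℤ.- i
  right s i = trans (·-neg s (s · i))
    (cong ℤ.-_ (trans (sym (·-assoc s s i)) (cong (_· i) (Signₚ.s*s≡+ s))))

-- The product is composition of functions, with the right factor applied first.
Sym : ℕ → Grp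
Sym n = record
  { Carrier = Permutation′ n
  ; _≈_     = Perm._≈_
  ; _∙_     = λ π ρ → ρ ∘ₚ π
  ; ε       = Perm.id
  ; _⁻¹     = Perm.flip
  ; isGroup = record
    { isMonoid = record
      { isSemigroup = record
        { isMagma = record
          { isEquivalence = record
            { refl  = λ _ → refl
            ; sym   = λ p i → sym (p i)
            ; trans = λ p q i → trans (p i) (q i)
            }
          ; ∙-cong = λ {π} {π′} {ρ} {ρ′} p q i →
              trans (cong (π ⟨$⟩ʳ_) (q i)) (p (ρ′ ⟨$⟩ʳ i))
          }
        ; assoc = λ _ _ _ _ → refl
        }
      ; identity = (λ _ _ → refl) , (λ _ _ → refl)
      }
    ; inverse = (λ π _ → Perm.inverseˡ π) , (λ π _ → Perm.inverseʳ π)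
    ; ⁻¹-cong = λ {π} {ρ} p i →
        trans (sym (Perm.inverseˡ ρ))
          (cong (ρ ⟨$⟩ˡ_) (trans (sym (p (π ⟨$⟩ˡ i))) (Perm.inverseʳ π)))
    }
  }

infixr 6 _×ᴳ_
_×ᴳ_ : Grp → Grp → Grp
_×ᴳ_ = DirectProduct.group

∏C : ∀ {k} → Vec ℕ k → Grp
∏C []       = Terminal.group
∏C (n ∷ ns) = C n ×ᴳ ∏C ns

{-# OPTIONS --safe #-}
module Submission where

-- Each of the groups in question contains a dihedral group D n with n ≥ 2: the
-- Klein four-group is D 2, and a symmetric group on at least three points
-- contains D 3.  So it is enough that T(G, H) = ∞ for every finite group G in
-- which some D n with n ≥ 2 embeds (contains-D⇒T≡∞).
--
-- The colouring.  Enumerate H, beginning with the identity, and let L m be the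
-- finite subgroup generated by the first m entries.  In each left coset of L m
-- the earliest element is the leader; an element is the product of the leader of
-- its coset and a remainder in L m, and the position of the leader is the digit
-- of the element at level m.  Passing from an element to its remainder at lower
-- and lower levels gives its finite sequence of digits.  For a pair of elements,
-- go through the levels from the top down and note the sign of the difference of
-- the two digits wherever they differ.  The oscillation of the pair is the
-- number of sign changes in this sequence.  To refute the bound p ≥ 1, an
-- embedding of G in H is coloured by the oscillation, modulo p + 1, of the
-- images of two reflections generating D n.
--
-- All p + 1 colours occur after composing with any embedding w of H in itself.
-- By homogeneity, H contains a coherent sequence of generalized dihedral groups
-- (ℤ/n)ᴺ ⋊ {±1} (Hall-tower).  Let z₀, z₁, … be the images under w of the
-- generators of the cyclic factors and τ that of the inversion.  Multiplying on
-- the right by an element of L m leaves the digits at levels m and above alone,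
-- and multiplies the remainder at level m by that element.  Let ν be a remainder
-- produced by factors chosen further up.  Among more than |L m| of the elements
-- ν zⱼ, two have the same remainder at level m.  They are distinct, so some of
-- their digits at levels m and above differ; exchanging the two reverses all the
-- signs noted there and changes nothing below.  Repeating this p times gives p
-- pairs of indices.  Distributing each pair between two products x and y of
-- zⱼ's, the order of each pair decides whether or not one more sign change
-- occurs where the signs of that pair begin, so that the oscillation of (x τ, y
-- τ) can be made base, base + 1, …, base + p for a fixed base (spread). The
-- pools of candidates are chosen from the bottom up, since their elements
-- determine how far up the next pool must work, and the two indices of each pool
-- from the top down, since they depend on ν.  Finally x τ and y τ are the images
-- under w of reflections generating a copy of D n, and by homogeneity the
-- corresponding embedding of D n in H extends to G.

open import Defs
open import Algebra.Bundles using (Group)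
open import Algebra.Morphism.Structures using (module GroupMorphisms)
import Algebra.Properties.Group as GroupProperties
open import Data.Fin.Base as Fin using (Fin; toℕ; combine; remQuot)
open import Data.Fin.Permutation as Perm
  using (Permutation′; permutation; lift₀; lift₀-cong; lift₀-comp; _⟨$⟩ʳ_;
         insert; remove; insert-remove; remove-insert)
import Data.Fin.Properties as Finₚ
open import Data.Fin.Subset as Subset using (_∈_; _⊆_; ⊤)
open import Data.Fin.Subset.Properties using (∣⊤∣≡n; p⊆q⇒∣p∣≤∣q∣)
open import Data.Integer.Base as ℤ using (ℤ; +_)
open import Data.Integer.DivMod using (_%ℕ_; _/ℕ_; a≡a%ℕn+[a/ℕn]*n; n%ℕd<d)
open import Data.Integer.Divisibility.Signed as ℤ∣ using (divides; ∣⇒∣ᵤ; ∣ᵤ⇒∣)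
import Data.Integer.Properties as ℤₚ
import Data.Integer.Tactic.RingSolver as ℤ-Solver
open import Data.List.Base using (List; []; _∷_; _++_; map; applyUpTo)
open import Data.List.Membership.Propositional.Properties
  using (∈-applyUpTo⁺; ∈-applyUpTo⁻)
open import Data.List.Properties
  using (map-++; map-id; ++-assoc; ++-identityʳ; ++-conicalˡ; ++-conicalʳ)
open import Data.Nat.Base as ℕ
  using (ℕ; zero; suc; _+_; _*_; _⊔_; _≤_; _<_; z≤n; s≤s; s<s; z<s; NonZero)
open import Data.Nat.DivMod
  using (_%_; _mod_; %-distribˡ-+; [m+kn]%n≡m%n; m%n%n≡m%n; m%n<n; m<n⇒m%n≡m)
open import Data.Nat.Divisibility as ℕ∣ using (_∣_)
import Data.Nat.Properties as ℕₚ
import Data.Nat.Tactic.RingSolver as ℕ-Solver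
open import Data.Product.Base using (Σ-syntax; ∃-syntax; _×_; _,_; proj₁; proj₂)
open import Data.Product.Relation.Binary.Pointwise.NonDependent using (_×ₛ_)
open import Data.Sign.Base as Sign using (Sign)
import Data.Sign.Properties as Signₚ
open import Data.Sum.Base using (_⊎_; inj₁; inj₂)
open import Data.Vec.Base using (Vec; []; _∷_; lookup)
open import Function.Base using (_∘_; id)
open import Function.Bundles using (Func; Inverse)
import Function.Construct.Composition as Compose
import Function.Construct.Identity as Identity
open import Level using (0ℓ)
open import Relation.Binary.Bundles using (Setoid)
open import Relation.Binary.Definitions using (tri<; tri≈; tri>)
open import Relation.Binary.PropositionalEquality as ≡ using (_≡_; _≢_; cong; cong₂)
import Relation.Binary.Reasoning.Setoid as SetoidReasoning
open import Relation.Nullary.Decidable using (Dec; yes; no; map′)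
open import Relation.Nullary.Negation using (¬_; contradiction)
open import Relation.Unary using (Decidable)

-- Embeddings of groups

module Embedding {A B : Grp} (f : Emb A B) where
  open Emb f public using (to)
  open GroupMorphisms.IsGroupMonomorphism (Emb.isEmbedding f) public
    using (injective; ε-homo; ⁻¹-homo) renaming (⟦⟧-cong to to-cong; ∙-homo to homo)

-- A homomorphism with trivial kernel is an embedding.
module _ (A B : Grp) where
  private
    module A = Group A
    module B = Group B

  embedding : (f : A.Carrier → B.Carrier) →
    (∀ {x y} → x A.≈ y → f x B.≈ f y) →
    (∀ x y → f (x A.∙ y) B.≈ f x B.∙ f y) →
    (∀ x → f x B.≈ B.ε → x A.≈ A.ε) → Emb A B
  embedding f f-cong f-homo f-kernel = record
    { to          = f
    ; isEmbedding = record
      { isGroupHomomorphism = record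
        { isMonoidHomomorphism = record
          { isMagmaHomomorphism = record
            { isRelHomomorphism = record { cong = f-cong }
            ; homo              = f-homo
            }
          ; ε-homo = f-ε
          }
        ; ⁻¹-homo = f-⁻¹
        }
      ; injective = λ {x} {y} eq → GroupProperties.x∙y⁻¹≈ε⇒x≈y A x y (f-kernel _
          (B.trans (f-homo _ _) (B.trans (B.∙-congˡ (f-⁻¹ y))
            (GroupProperties.x≈y⇒x∙y⁻¹≈ε B eq))))
      }
    }
    where
    f-ε : f A.ε B.≈ B.ε
    f-ε = GroupProperties.identityˡ-unique B _ _
      (B.trans (B.sym (f-homo A.ε A.ε)) (f-cong (A.identityˡ A.ε)))
    f-⁻¹ : ∀ x → f (x A.⁻¹) B.≈ f x B.⁻¹
    f-⁻¹ x = GroupProperties.inverseˡ-unique B _ _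
      (B.trans (B.sym (f-homo _ _)) (B.trans (f-cong (A.inverseˡ x)) f-ε))

≅⇒Emb : ∀ {A B} → A ≅ B → Emb A B
≅⇒Emb φ = record
  { to          = _≅_.to φ
  ; isEmbedding = GroupMorphisms.IsGroupIsomorphism.isGroupMonomorphism (_≅_.isIso φ)
  }

≅⇒Inverse : ∀ {A B} → A ≅ B → Inverse (Group.setoid A) (Group.setoid B)
≅⇒Inverse {A} {B} φ = record
  { to        = φ.to
  ; from      = from
  ; to-cong   = φ.to-cong
  ; from-cong = λ {x} {y} x≈y →
      φ.injective (B.trans (to-from x) (B.trans x≈y (B.sym (to-from y))))
  ; inverse   = (λ {y} x≈ → B.trans (φ.to-cong x≈) (to-from y))
              , (λ {x} {y} y≈ → φ.injective (B.trans (to-from y) y≈))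
  }
  where
  module A = Group A
  module B = Group B
  module φ = Embedding (≅⇒Emb φ)
  surjective = GroupMorphisms.IsGroupIsomorphism.surjective (_≅_.isIso φ)
  from : B.Carrier → A.Carrier
  from y = proj₁ (surjective y)
  to-from : ∀ y → φ.to (from y) B.≈ y
  to-from y = proj₂ (surjective y) A.refl

≅⇒Emb⁻¹ : ∀ {A B} → A ≅ B → Emb B A
≅⇒Emb⁻¹ {A} {B} φ = embedding B A I.from I.from-cong
  (λ x y → φ.injective (B.trans (I.strictlyInverseˡ _) (B.trans
    (B.∙-cong (B.sym (I.strictlyInverseˡ x)) (B.sym (I.strictlyInverseˡ y)))
    (B.sym (φ.homo _ _)))))
  (λ x eq → B.trans (B.sym (I.strictlyInverseˡ x)) (B.trans (φ.to-cong eq) φ.ε-homo))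
  where
  module B = Group B
  module φ = Embedding (≅⇒Emb φ)
  module I = Inverse (≅⇒Inverse φ)

≲⇒Emb : ∀ {K G} → K ≲ G → Emb K G
≲⇒Emb {K} {G} (P , φ) = embedding K G (proj₁ ∘ φ.to) φ.to-cong φ.homo
  (λ x eq → φ.injective (Group.trans G eq (Group.sym G φ.ε-homo)))
  where module φ = Embedding (≅⇒Emb φ)

-- Finite setoids

-- A setoid with finitely many elements, counted by a bijection with some Fin n.
Finite : Setoid 0ℓ 0ℓ → Set
Finite S = ∃[ n ] Inverse S (≡.setoid (Fin n))

Finite-≅ : ∀ {S T : Setoid 0ℓ 0ℓ} → Inverse S T → Finite T → Finite S
Finite-≅ S≅T (n , T≅n) = n , Compose.inverse S≅T T≅n

Finite-× : ∀ {S T : Setoid 0ℓ 0ℓ} → Finite S → Finite T → Finite (S ×ₛ T)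
Finite-× {S} {T} (m , f) (n , g) = m * n , record
  { to        = λ { (x , y) → combine (f.to x) (g.to y) }
  ; from      = λ i → f.from (proj₁ (remQuot n i)) , g.from (proj₂ (remQuot {m} n i))
  ; to-cong   = λ { (p , q) → cong₂ combine (f.to-cong p) (g.to-cong q) }
  ; from-cong = λ { ≡.refl → S.refl , T.refl }
  ; inverse   =
      (λ { {i} (p , q) → ≡.trans (cong₂ combine (f.inverseˡ p) (g.inverseˡ q))
                                 (Finₚ.combine-remQuot {m} n i) })
    , (λ { {x , y} ≡.refl →
          f.inverseʳ (cong proj₁ (Finₚ.remQuot-combine (f.to x) (g.to y)))
        , g.inverseʳ (cong proj₂ (Finₚ.remQuot-combine (f.to x) (g.to y))) })
  }
  where
  module S = Setoid S
  module T = Setoid T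
  module f = Inverse f
  module g = Inverse g

Finite-Fin : ∀ n → Finite (≡.setoid (Fin n))
Finite-Fin n = n , Identity.inverse (≡.setoid (Fin n))

Finite-Sign : Finite (≡.setoid Sign)
Finite-Sign = 2 , record
  { to = to ; from = from ; to-cong = cong to ; from-cong = cong from
  ; inverse = (λ { {Fin.zero} ≡.refl → ≡.refl ; {Fin.suc Fin.zero} ≡.refl → ≡.refl })
            , (λ { {Sign.+} ≡.refl → ≡.refl ; {Sign.-} ≡.refl → ≡.refl }) }
  where
  to : Sign → Fin 2
  to Sign.+ = Fin.zero
  to Sign.- = Fin.suc Fin.zero
  from : Fin 2 → Sign
  from Fin.zero           = Sign.+
  from (Fin.suc Fin.zero) = Sign.-

Finite-trivial : ∀ {S : Setoid 0ℓ 0ℓ} → (x : Setoid.Carrier S) →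
                 (∀ y → Setoid._≈_ S x y) → Finite S
Finite-trivial {S} x x≈ = 1 , record
  { to = λ _ → Fin.zero ; from = λ _ → x ; to-cong = λ _ → ≡.refl
  ; from-cong = λ _ → Setoid.refl S
  ; inverse = (λ { {Fin.zero} _ → ≡.refl }) , (λ {y} _ → x≈ y) }

-- Residues modulo n

residue-unique : ∀ n {a b} → a < n → b < n → + a ≡ + b [mod n ] → a ≡ b
residue-unique n {a} {b} a<n b<n p = ℕₚ.≤-antisym
  (residue-≤ b a a<n (mod-sym {+ a} {+ b} p)) (residue-≤ a b b<n p)
  where
  open Mod n
  small : ∀ {d} → d < n → n ℕ∣.∣ d → d ≡ 0
  small {zero}  _   _   = ≡.refl
  small {suc d} d<n n∣d = contradiction (ℕ∣.∣⇒≤ n∣d) (ℕₚ.<⇒≱ d<n)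
  residue-≤ : ∀ a b → b < n → + a ≡ + b [mod n ] → b ≤ a
  residue-≤ a b b<n p with ℕₚ.≤-total a b
  ... | inj₂ b≤a = b≤a
  ... | inj₁ a≤b = ℕₚ.m∸n≡0⇒m≤n (small (ℕₚ.≤-<-trans (ℕₚ.m∸n≤m b a) b<n)
    (≡.subst (n ℕ∣.∣_) (≡.trans (cong ℤ.∣_∣ (ℤₚ.m-n≡m⊖n a b)) (ℤₚ.∣⊖∣-≤ a≤b)) (∣⇒∣ᵤ p)))

module _ (n : ℕ) .{{_ : NonZero n}} where
  open Mod n

  %-≡mod : ∀ i → + (i %ℕ n) ≡ i [mod n ]
  %-≡mod i = mod-sym {i} {+ (i %ℕ n)} (divides (i /ℕ n) eq)
    where
    eq : i ℤ.- + (i %ℕ n) ≡ (i /ℕ n) ℤ.* + n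
    eq = ≡.trans (cong (ℤ._- + (i %ℕ n)) (a≡a%ℕn+[a/ℕn]*n i n)) (cancel (+ (i %ℕ n)) _)
      where
      cancel : ∀ a b → (a ℤ.+ b) ℤ.- a ≡ b
      cancel = ℤ-Solver.solve-∀

  C-finite : IsFinite (C n)
  C-finite = n , record
    { to        = to
    ; from      = λ a → + Fin.toℕ a
    ; to-cong   = λ {i} {j} → to-cong {i} {j}
    ; from-cong = λ { {a} ≡.refl → ≡⇒ {+ Fin.toℕ a} ≡.refl }
    ; inverse   = (λ {a} {i} p → Finₚ.toℕ-injective (≡.trans (Finₚ.toℕ-fromℕ< _)
                    (residue-unique n (n%ℕd<d i n) (Finₚ.toℕ<n a)
                      (mod-trans {+ (i %ℕ n)} {i} {+ Fin.toℕ a} (%-≡mod i) p))))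
                , (λ { {i} ≡.refl → ≡.subst (λ a → + a ≡ i [mod n ])
                    (≡.sym (Finₚ.toℕ-fromℕ< _)) (%-≡mod i) })
    }
    where
    to : ℤ → Fin n
    to i = Fin.fromℕ< (n%ℕd<d i n)
    to-cong : ∀ {i j} → i ≡ j [mod n ] → to i ≡ to j
    to-cong {i} {j} p = Finₚ.fromℕ<-cong _ _ (residue-unique n (n%ℕd<d i n) (n%ℕd<d j n)
      (mod-trans {+ (i %ℕ n)} {i} {+ (j %ℕ n)} (%-≡mod i)
        (mod-trans {i} {j} {+ (j %ℕ n)} p
          (mod-sym {+ (j %ℕ n)} {j} (%-≡mod j))))) _ _

  D-finite : IsFinite (D n)
  D-finite = Finite-≅ {S = Group.setoid (D n)} {T = Group.setoid (C n) ×ₛ ≡.setoid Sign}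
    (record { to = id ; from = id ; to-cong = id ; from-cong = id ; inverse = id , id })
    (Finite-× C-finite Finite-Sign)

-- Extending embeddings into Hall's group

module _ {K H : Grp} (f : Emb K H) where
  private
    module K = Group K
    module H = Group H
    module f = Embedding f

  image : Subgroup H
  image = record
    { Member    = λ h → Σ[ k ∈ K.Carrier ] f.to k H.≈ h
    ; resp      = λ { h≈h′ (k , p) → k , H.trans p h≈h′ }
    ; ε-closed  = K.ε , f.ε-homo
    ; ∙-closed  = λ { (k , p) (l , q) → k K.∙ l , H.trans (f.homo k l) (H.∙-cong p q) }
    ; ⁻¹-closed = λ { (k , p) → k K.⁻¹ , H.trans (f.⁻¹-homo k) (H.⁻¹-cong p) }
    }

  -- The map sending f k back to k.
  preimage : Emb (toGroup image) K
  preimage = embedding (toGroup image) K (λ { (_ , k , _) → k })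
    (λ { {_ , _ , p} {_ , _ , q} h≈ → f.injective (H.trans p (H.trans h≈ (H.sym q))) })
    (λ _ _ → K.refl)
    (λ { (_ , k , p) k≈ε → H.trans (H.sym p) (H.trans (f.to-cong k≈ε) f.ε-homo) })

  image-finite : IsFinite K → IsFinite (toGroup image)
  image-finite = Finite-≅ (record
    { to        = Emb.to preimage
    ; from      = λ k → f.to k , k , H.refl
    ; to-cong   = λ {x} {y} → Embedding.to-cong preimage {x} {y}
    ; from-cong = f.to-cong
    ; inverse   = (λ { {_} {_ , _ , p} q → f.injective (H.trans p q) })
                , (λ { {_ , _ , p} q → H.trans (f.to-cong q) p })
    })

-- The isomorphism between the images of two embeddings f and g of the same
-- group that sends f k to g k.
image-≅ : ∀ {K H} (f g : Emb K H) → toGroup (image f) ≅ toGroup (image g)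
image-≅ {K} {H} f g = record
  { to    = λ { (_ , k , _) → g.to k , k , H.refl }
  ; isIso = record
    { isGroupMonomorphism = Emb.isEmbedding (embedding (toGroup (image f)) (toGroup (image g))
        (λ { (_ , k , _) → g.to k , k , H.refl })
        (λ {x} {y} x≈y → g.to-cong (f⁻¹.to-cong {x} {y} x≈y))
        (λ { (_ , k , _) (_ , l , _) → g.homo k l })
        (λ { x@(_ , k , p) eq → H.trans (H.sym p) (H.trans
             (f.to-cong (g.injective (H.trans eq (H.sym g.ε-homo)))) f.ε-homo) }))
    ; surjective = λ { (h , k , p) → (f.to k , k , H.refl) ,
        λ { {_ , _ , r} q → H.trans (g.to-cong (f.injective (H.trans r q))) p } }
    }
  }
  where
  module K = Group K
  module H = Group H
  module f = Embedding f
  module g = Embedding g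
  module f⁻¹ = Embedding (preimage f)

-- Embeddings in H extend from K to a finite overgroup G: embed G in H by
-- universality, and move the resulting copy of K onto the given one by an
-- automorphism of H.
extend : ∀ {H} → IsHallUniversal H → ∀ {K G} → IsFinite K → IsFinite G →
         (ι : Emb K G) (f : Emb K H) →
         Σ[ g ∈ Emb G H ] (∀ x → Group._≈_ H (Emb.to g (Emb.to ι x)) (Emb.to f x))
extend {H} hall {K} {G} Kfin Gfin ι f =
  ≅⇒Emb α ∘ₑ u , λ x → extends (u∘ι.to x , x , H.refl)
  where
  module H = Group H
  open IsHallUniversal hall
  u : Emb G H
  u = universal G Gfin
  u∘ι : Emb K H
  u∘ι = u ∘ₑ ι
  module u∘ι = Embedding u∘ι
  moved : Σ[ α ∈ H ≅ H ] (∀ x → _≅_.to α (proj₁ x) H.≈ proj₁ (_≅_.to (image-≅ u∘ι f) x))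
  moved = homogeneous (image u∘ι) (image f)
    (image-finite u∘ι Kfin) (image-finite f Kfin) (image-≅ u∘ι f)
  α = proj₁ moved
  extends = proj₂ moved

-- Generalized dihedral groups

module GeneralizedDihedral (n : ℕ) where
  open Mod n
  private module Dₙ = Group (D n)

  -- A vector of exponents.  The same infinite sequences serve for all lengths N:
  -- only equality, which compares the first N entries modulo n, depends on N.
  Exponents : Set
  Exponents = ℕ → ℤ

  infixl 6 _⊕_
  _⊕_ : Exponents → Exponents → Exponents
  (u ⊕ v) i = u i ℤ.+ v i

  𝟘 : Exponents
  𝟘 _ = + 0

  ExponentSetoid : ℕ → Setoid 0ℓ 0ℓ
  ExponentSetoid N = record
    { Carrier       = Exponents
    ; _≈_           = λ u v → ∀ i → i < N → u i ≡ v i [mod n ]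
    ; isEquivalence = record
      { refl  = λ {u} i _ → ≡⇒ {u i} ≡.refl
      ; sym   = λ {u} {v} p i i< → mod-sym {u i} {v i} (p i i<)
      ; trans = λ {u} {v} {w} p q i i< → mod-trans {u i} {v i} {w i} (p i i<) (q i i<)
      }
    }

  -- The semidirect product of (ℤ/nℤ)ᴺ by {±1} acting by negation.  Coordinatewise
  -- the operations are those of D n, from which the laws are inherited.
  Dih : ℕ → Grp
  Dih N = record
    { Carrier = Exponents × Sign
    ; _≈_     = λ { (u , s) (v , t) → (∀ i → i < N → u i ≡ v i [mod n ]) × s ≡ t }
    ; _∙_     = λ { (u , s) (v , t) → (λ i → u i ℤ.+ s · v i) , s Sign.* t }
    ; ε       = 𝟘 , Sign.+
    ; _⁻¹     = λ { (u , s) → (λ i → ℤ.- (s · u i)) , s }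
    ; isGroup = record
      { isMonoid = record
        { isSemigroup = record
          { isMagma = record
            { isEquivalence = record
              { refl  = λ { {u , _} → E.refl {u} , ≡.refl }
              ; sym   = λ { {u , _} {v , _} (p , q) → E.sym {u} {v} p , ≡.sym q }
              ; trans = λ { {u , _} {v , _} {w , _} (p , q) (p′ , q′) →
                            E.trans {u} {v} {w} p p′ , ≡.trans q q′ }
              }
            ; ∙-cong = λ { {u , s} {u′ , s′} {v , t} {v′ , t′} (p , q) (p′ , q′) →
                (λ i i< → proj₁ (Dₙ.∙-cong {u i , s} {u′ i , s′} {v i , t} {v′ i , t′}
                            (p i i< , q) (p′ i i< , q′)))
                , cong₂ Sign._*_ q q′ }
            }
          ; assoc = λ { (u , s) (v , t) (w , r) →
              (λ i _ → proj₁ (Dₙ.assoc (u i , s) (v i , t) (w i , r)))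
              , Signₚ.*-assoc s t r }
          }
        ; identity =
            (λ { (u , s) → (λ i _ → proj₁ (Dₙ.identityˡ (u i , s))) , ≡.refl })
          , (λ { (u , s) → (λ i _ → proj₁ (Dₙ.identityʳ (u i , s))) , Signₚ.*-identityʳ s })
        }
      ; inverse =
          (λ { (u , s) → (λ i _ → proj₁ (Dₙ.inverseˡ (u i , s))) , Signₚ.s*s≡+ s })
        , (λ { (u , s) → (λ i _ → proj₁ (Dₙ.inverseʳ (u i , s))) , Signₚ.s*s≡+ s })
      ; ⁻¹-cong = λ { {u , s} {v , t} (p , q) →
          (λ i i< → proj₁ (Dₙ.⁻¹-cong {u i , s} {v i , t} (p i i< , q))) , q }
      }
    }
    where module E = Setoid (ExponentSetoid N)

  -- The sequence u preceded by i.
  shift : ℤ → Exponents → Exponents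
  shift i u zero    = i
  shift i u (suc j) = u j

  module _ .{{_ : NonZero n}} where
    Exponents-finite : ∀ N → Finite (ExponentSetoid N)
    Exponents-finite zero    = Finite-trivial 𝟘 (λ _ _ ())
    Exponents-finite (suc N) = Finite-≅ {T = Group.setoid (C n) ×ₛ ExponentSetoid N}
      (record
        { to        = λ u → u 0 , u ∘ suc
        ; from      = λ { (i , u) → shift i u }
        ; to-cong   = λ p → p 0 z<s , λ i i< → p (suc i) (s<s i<)
        ; from-cong = λ { (p , q) zero _ → p ; (p , q) (suc i) (s≤s i<) → q i i< }
        ; inverse   = (λ p → p 0 z<s , λ i i< → p (suc i) (s<s i<))
                    , (λ { (p , q) zero _ → p ; (p , q) (suc i) (s≤s i<) → q i i< })
        })
      (Finite-× (C-finite n) (Exponents-finite N))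

    Dih-finite : ∀ N → IsFinite (Dih N)
    Dih-finite N = Finite-≅ {T = ExponentSetoid N ×ₛ ≡.setoid Sign}
      (record { to = id ; from = id ; to-cong = id ; from-cong = id ; inverse = id , id })
      (Finite-× (Exponents-finite N) Finite-Sign)

  -- The exponents below N, continued by zeros.
  truncate : ℕ → Exponents → Exponents
  truncate zero    u i       = + 0
  truncate (suc N) u zero    = u 0
  truncate (suc N) u (suc i) = truncate N (u ∘ suc) i

  truncate-< : ∀ {N i} u → i < N → truncate N u i ≡ u i
  truncate-< {suc N} {zero}  u _         = ≡.refl
  truncate-< {suc N} {suc i} u (s≤s i<N) = truncate-< (u ∘ suc) i<N

  truncate-top : ∀ N u → truncate N u N ≡ + 0
  truncate-top zero    u = ≡.refl
  truncate-top (suc N) u = truncate-top N (u ∘ suc)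

  truncate-∙ : ∀ N s u v i →
    truncate N (λ i → u i ℤ.+ s · v i) i ≡ truncate N u i ℤ.+ s · truncate N v i
  truncate-∙ zero    s u v i       =
    ≡.sym (≡.trans (ℤₚ.+-identityˡ (s · + 0)) (·-zero s))
  truncate-∙ (suc N) s u v zero    = ≡.refl
  truncate-∙ (suc N) s u v (suc i) = truncate-∙ N s (u ∘ suc) (v ∘ suc) i

  truncate-cong : ∀ N {u v} → (∀ i → i < N → u i ≡ v i [mod n ]) →
                  ∀ i → truncate N u i ≡ truncate N v i [mod n ]
  truncate-cong zero    p i       = ≡⇒ {+ 0} ≡.refl
  truncate-cong (suc N) p zero    = p 0 z<s
  truncate-cong (suc N) p (suc i) = truncate-cong N (λ i i< → p (suc i) (s<s i<)) i

  -- Dih N as the subgroup of Dih (suc N) of elements with last exponent zero.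
  inclusion : ∀ N → Emb (Dih N) (Dih (suc N))
  inclusion N = embedding (Dih N) (Dih (suc N))
    (λ { (u , s) → truncate N u , s })
    (λ { {u , _} {v , _} (p , q) → (λ i _ → truncate-cong N {u} {v} p i) , q })
    (λ { (u , s) (v , t) → (λ i _ → ≡⇒ (truncate-∙ N s u v i)) , ≡.refl })
    (λ { (u , s) (p , q) →
      (λ i i<N → ≡.subst (_≡ + 0 [mod n ]) (truncate-< u i<N) (p i (ℕₚ.m<n⇒m<1+n i<N))) , q })

  inclusion-≈ : ∀ N u s → u N ≡ + 0 →
    Group._≈_ (Dih (suc N)) (u , s) (truncate N u , s)
  inclusion-≈ N u s uN≡0 = agree , ≡.refl
    where
    agree : ∀ i → i < suc N → u i ≡ truncate N u i [mod n ]
    agree i i<1+N with ℕₚ.m<1+n⇒m<n∨m≡n i<1+N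
    ... | inj₁ i<N    = ≡⇒ (≡.sym (truncate-< u i<N))
    ... | inj₂ ≡.refl = ≡⇒ (≡.trans uN≡0 (≡.sym (truncate-top i u)))

  -- A sequence of embeddings of the groups Dih N in H.  Coherence says that stage
  -- suc N restricts to stage N on the elements whose exponent at N vanishes, so that
  -- the sequence amounts to an embedding of the union of the groups.
  record Tower (H : Grp) : Set where
    open Group H using (_≈_)
    field
      stage    : ∀ N → Emb (Dih N) H
      coherent : ∀ N u s → u N ≡ + 0 →
                 Emb.to (stage (suc N)) (u , s) ≈ Emb.to (stage N) (u , s)

    coherent-≤ : ∀ k N u s → (∀ i → N ≤ i → u i ≡ + 0) →
                 Emb.to (stage (k + N)) (u , s) ≈ Emb.to (stage N) (u , s)
    coherent-≤ zero    N u s u≥N = Group.refl H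
    coherent-≤ (suc k) N u s u≥N = Group.trans H
      (coherent (k + N) u s (u≥N _ (ℕₚ.m≤n+m N k))) (coherent-≤ k N u s u≥N)

  Hall-tower : .{{_ : NonZero n}} → ∀ {H} → IsHallUniversal H → Tower H
  Hall-tower {H} hall = record
    { stage    = stage
    ; coherent = λ N u s uN≡0 → Group.trans H
        (Embedding.to-cong (stage (suc N)) (inclusion-≈ N u s uN≡0))
        (proj₂ (next N (stage N)) (u , s))
    }
    where
    next : ∀ N (f : Emb (Dih N) H) → Σ[ g ∈ Emb (Dih (suc N)) H ]
      (∀ x → Group._≈_ H (Emb.to g (Emb.to (inclusion N) x)) (Emb.to f x))
    next N f = extend hall (Dih-finite N) (Dih-finite (suc N)) (inclusion N) f
    stage : ∀ N → Emb (Dih N) H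
    stage zero    = IsHallUniversal.universal hall (Dih 0) (Dih-finite 0)
    stage (suc N) = proj₁ (next N (stage N))

  -- The image of a tower under an embedding.
  push : ∀ {H H′} → Emb H H′ → Tower H → Tower H′
  push w T = record
    { stage    = λ N → w ∘ₑ T.stage N
    ; coherent = λ N u s eq → Embedding.to-cong w (T.coherent N u s eq)
    }
    where module T = Tower T

  -- Some entry of v - u below N is ±1.  Then v - u has order n in (ℤ/nℤ)ᴺ, and the
  -- reflections with exponents u and v generate a dihedral group of order 2n.
  Separated : ℕ → Exponents → Exponents → Set
  Separated N u v = ∃[ j ] j < N × (v j ℤ.- u j ≡ + 1 ⊎ v j ℤ.- u j ≡ ℤ.- + 1)

  module _ (u v : Exponents) where

    offset : Sign → ℤ → ℤ
    offset Sign.+ _ = + 0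
    offset Sign.- a = a

    -- The exponents of the image of (i , s) under the homomorphism from D n that
    -- sends the reflections (0 , -) and (1 , -) to (u , -) and (v , -).
    word : ℤ → Sign → Exponents
    word i s j = offset s (u j) ℤ.+ i ℤ.* (v j ℤ.- u j)

    private
      homo-+ : ∀ a i k d → a ℤ.+ (i ℤ.+ k) ℤ.* d ≡ (+ 0 ℤ.+ i ℤ.* d) ℤ.+ (a ℤ.+ k ℤ.* d)
      homo-+ = ℤ-Solver.solve-∀
      homo-−+ : ∀ a i k d →
        a ℤ.+ (i ℤ.- k) ℤ.* d ≡ (a ℤ.+ i ℤ.* d) ℤ.- (+ 0 ℤ.+ k ℤ.* d)
      homo-−+ = ℤ-Solver.solve-∀
      homo-−− : ∀ a i k d →
        + 0 ℤ.+ (i ℤ.- k) ℤ.* d ≡ (a ℤ.+ i ℤ.* d) ℤ.- (a ℤ.+ k ℤ.* d)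
      homo-−− = ℤ-Solver.solve-∀
      diff : ∀ a i k d → (i ℤ.- k) ℤ.* d ≡ (a ℤ.+ i ℤ.* d) ℤ.- (a ℤ.+ k ℤ.* d)
      diff = ℤ-Solver.solve-∀
      by-one : ∀ i → (+ 0 ℤ.+ i ℤ.* + 1) ℤ.- + 0 ≡ i ℤ.- + 0
      by-one = ℤ-Solver.solve-∀
      by-minus-one : ∀ i → ℤ.- ((+ 0 ℤ.+ i ℤ.* (ℤ.- + 1)) ℤ.- + 0) ≡ i ℤ.- + 0
      by-minus-one = ℤ-Solver.solve-∀

    word-homo : ∀ s t i k j →
      word (i ℤ.+ s · k) (s Sign.* t) j ≡ word i s j ℤ.+ s · word k t j
    word-homo Sign.+ t      i k j = homo-+ (offset t (u j)) i k _
    word-homo Sign.- Sign.+ i k j = homo-−+ (u j) i k _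
    word-homo Sign.- Sign.- i k j = homo-−− (u j) i k _

    word-cong : ∀ s {i k} → i ≡ k [mod n ] → ∀ j → word i s j ≡ word k s j [mod n ]
    word-cong s {i} {k} p j = ≡.subst (+ n ℤ∣.∣_) (diff (offset s (u j)) i k _)
      (ℤ∣.∣m⇒∣m*n _ p)

    reflections : ∀ {N} → Separated N u v → Emb (D n) (Dih N)
    reflections {N} (j , j<N , v-u≡±1) = embedding (D n) (Dih N)
      (λ { (i , s) → word i s , s })
      (λ { {i , s} {k , _} (p , ≡.refl) → (λ j _ → word-cong s {i} {k} p j) , ≡.refl })
      (λ { (i , s) (k , t) → (λ j _ → ≡⇒ (word-homo s t i k j)) , ≡.refl })
      (λ { (i , _) (p , ≡.refl) → kernel i (p j j<N) v-u≡±1 , ≡.refl })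
      where
      kernel : ∀ i → word i Sign.+ j ≡ + 0 [mod n ] →
        v j ℤ.- u j ≡ + 1 ⊎ v j ℤ.- u j ≡ ℤ.- + 1 → i ≡ + 0 [mod n ]
      kernel i p (inj₁ eq) rewrite eq = ≡.subst (+ n ℤ∣.∣_) (by-one i) p
      kernel i p (inj₂ eq) rewrite eq = ≡.subst (+ n ℤ∣.∣_) (by-minus-one i) (ℤ∣.∣m⇒∣-m p)

    word-0 : ∀ j → word (+ 0) Sign.- j ≡ u j
    word-0 j = ℤₚ.+-identityʳ (u j)

    word-1 : ∀ j → word (+ 1) Sign.- j ≡ v j
    word-1 j = lemma (u j) (v j)
      where
      lemma : ∀ a b → a ℤ.+ + 1 ℤ.* (b ℤ.- a) ≡ b
      lemma = ℤ-Solver.solve-∀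

  -- The j-th unit vector.
  δ : ℕ → Exponents
  δ zero    zero    = + 1
  δ zero    (suc _) = + 0
  δ (suc _) zero    = + 0
  δ (suc j) (suc i) = δ j i

  δ-diagonal : ∀ j → δ j j ≡ + 1
  δ-diagonal zero    = ≡.refl
  δ-diagonal (suc j) = δ-diagonal j

  δ-off-diagonal : ∀ j i → j ≢ i → δ j i ≡ + 0
  δ-off-diagonal zero    zero    j≢i = contradiction ≡.refl j≢i
  δ-off-diagonal zero    (suc i) j≢i = ≡.refl
  δ-off-diagonal (suc j) zero    j≢i = ≡.refl
  δ-off-diagonal (suc j) (suc i) j≢i = δ-off-diagonal j i (j≢i ∘ cong suc)

-- Sign sequences and their alternations

-- 1 if the two signs differ and 0 otherwise.
change : Sign → Sign → ℕ
change Sign.+ Sign.+ = 0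
change Sign.+ Sign.- = 1
change Sign.- Sign.+ = 1
change Sign.- Sign.- = 0

-- The number of places where the sequence s ∷ l changes sign.
alternations : Sign → List Sign → ℕ
alternations s []      = 0
alternations s (t ∷ l) = change s t + alternations t l

-- The last sign of s ∷ l.
lastSign : Sign → List Sign → Sign
lastSign s []      = s
lastSign s (t ∷ l) = lastSign t l

alternations-++ : ∀ s l l′ →
  alternations s (l ++ l′) ≡ alternations s l + alternations (lastSign s l) l′
alternations-++ s []      l′ = ≡.refl
alternations-++ s (t ∷ l) l′ = ≡.trans
  (cong (λ a → change s t + a) (alternations-++ t l l′))
  (≡.sym (ℕₚ.+-assoc (change s t) _ _))

change-* : ∀ ε s t → change (ε Sign.* s) (ε Sign.* t) ≡ change s t
change-* Sign.+ s      t      = ≡.refl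
change-* Sign.- Sign.+ Sign.+ = ≡.refl
change-* Sign.- Sign.+ Sign.- = ≡.refl
change-* Sign.- Sign.- Sign.+ = ≡.refl
change-* Sign.- Sign.- Sign.- = ≡.refl

alternations-* : ∀ ε s l →
  alternations (ε Sign.* s) (map (ε Sign.*_) l) ≡ alternations s l
alternations-* ε s []      = ≡.refl
alternations-* ε s (t ∷ l) = cong₂ _+_ (change-* ε s t) (alternations-* ε t l)

-- By a global change of sign, the sequence d ∷ l can be made to begin with any
-- given sign u.
alternations-scaled : ∀ s u d l → ∃[ ε ]
  alternations s (map (ε Sign.*_) (d ∷ l)) ≡ change s u + alternations d l
alternations-scaled s u d l = ε , ≡.trans
  (cong (λ v → change s v + alternations v (map (ε Sign.*_) l)) ε*d)
  (cong (λ a → change s u + a) (≡.trans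
    (cong (λ v → alternations v (map (ε Sign.*_) l)) (≡.sym ε*d))
    (alternations-* ε d l)))
  where
  ε : Sign
  ε = u Sign.* d
  ε*d : ε Sign.* d ≡ u
  ε*d = ≡.trans (Signₚ.*-assoc u d d)
          (≡.trans (cong (u Sign.*_) (Signₚ.s*s≡+ d)) (Signₚ.*-identityʳ u))

-- The sign of d′ - d as a one-element list, or the empty list if d = d′.
signs : ℕ → ℕ → List Sign
signs d d′ with ℕₚ.<-cmp d d′
... | tri< _ _ _ = Sign.+ ∷ []
... | tri≈ _ _ _ = []
... | tri> _ _ _ = Sign.- ∷ []

signs-refl : ∀ d → signs d d ≡ []
signs-refl d with ℕₚ.<-cmp d d
... | tri< _ d≢d _ = contradiction ≡.refl d≢d
... | tri≈ _ _ _   = ≡.refl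
... | tri> _ d≢d _ = contradiction ≡.refl d≢d

signs≡[] : ∀ d d′ → signs d d′ ≡ [] → d ≡ d′
signs≡[] d d′ eq with ℕₚ.<-cmp d d′
signs≡[] d d′ () | tri< _ _ _
signs≡[] d d′ eq | tri≈ _ d≡d′ _ = d≡d′
signs≡[] d d′ () | tri> _ _ _

signs-swap : ∀ d d′ → signs d′ d ≡ map (Sign.- Sign.*_) (signs d d′)
signs-swap d d′ with ℕₚ.<-cmp d d′ | ℕₚ.<-cmp d′ d
... | tri< _ _ _   | tri> _ _ _   = ≡.refl
... | tri≈ _ _ _   | tri≈ _ _ _   = ≡.refl
... | tri> _ _ _   | tri< _ _ _   = ≡.refl
... | tri< _ p _   | tri≈ _ q _   = contradiction (≡.sym q) p
... | tri< p _ _   | tri< _ _ q   = contradiction p q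
... | tri≈ _ p _   | tri< _ q _   = contradiction (≡.sym p) q
... | tri≈ _ p _   | tri> _ q _   = contradiction (≡.sym p) q
... | tri> _ p _   | tri≈ _ q _   = contradiction (≡.sym q) p
... | tri> _ _ p   | tri> q _ _   = contradiction p q

-- Least elements of decidable sets of natural numbers

-- k is the least element of P.
Least : (ℕ → Set) → ℕ → Set
Least P k = P k × (∀ {j} → j < k → ¬ P j)

least : ∀ {P : ℕ → Set} → Decidable P → ∀ n → P n → ∃[ k ] Least P k
least P? n p with P? 0
... | yes p₀ = 0 , p₀ , λ ()
least P? zero    p | no ¬p₀ = contradiction p ¬p₀
least P? (suc n) p | no ¬p₀ with least (P? ∘ suc) n p
... | k , pₖ , min = suc k , pₖ , λ { {zero} _ → ¬p₀ ; {suc _} (s≤s j<k) → min j<k }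

Least-unique : ∀ {P Q : ℕ → Set} → (∀ {i} → P i → Q i) → (∀ {i} → Q i → P i) →
               ∀ {k l} → Least P k → Least Q l → k ≡ l
Least-unique P⊆Q Q⊆P {k} {l} (pₖ , minP) (qₗ , minQ) with ℕₚ.<-cmp k l
... | tri< k<l _ _ = contradiction (P⊆Q pₖ) (minQ k<l)
... | tri≈ _ k≡l _ = k≡l
... | tri> _ _ l<k = contradiction (Q⊆P qₗ) (minP l<k)

-- Digits in a countable locally finite group

module Digits (H : Grp) (countable : IsCountablyInfinite H)
              (locallyFinite : IsLocallyFinite H) where

  open Group H
  open GroupProperties H
  open SetoidReasoning setoid
  private module # = Inverse countable

  -- An enumeration of H whose first entry is the identity.
  e : ℕ → Carrier
  e zero    = ε
  e (suc i) = #.from i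

  -- The subgroup L m generated by the first m entries of the enumeration.
  infix 4 _∈L_
  _∈L_ : Carrier → ℕ → Set
  x ∈L m = Generated H (applyUpTo e m) x

  e∈L : ∀ {i m} → i < m → e i ∈L m
  e∈L i<m = gen (∈-applyUpTo⁺ e i<m)

  L-mono : ∀ {m n x} → m ≤ n → x ∈L m → x ∈L n
  L-mono m≤n (gen x∈) with ∈-applyUpTo⁻ e x∈
  ... | i , i<m , ≡.refl = e∈L (ℕₚ.<-≤-trans i<m m≤n)
  L-mono m≤n (resp x≈y p) = resp x≈y (L-mono m≤n p)
  L-mono m≤n unit         = unit
  L-mono m≤n (mul p q)    = mul (L-mono m≤n p) (L-mono m≤n q)
  L-mono m≤n (inv p)      = inv (L-mono m≤n p)

  L-up : ∀ k {m x} → x ∈L m → x ∈L (k + m)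
  L-up k {m} = L-mono (ℕₚ.m≤n+m m k)

  -- A position at which x is enumerated.
  code : Carrier → ℕ
  code x = suc (#.to x)

  e-code : ∀ x → e (code x) ≈ x
  e-code = #.strictlyInverseʳ

  -- A level with x ∈ L (rank x).  Nothing else about it matters, so its value is
  -- kept abstract.
  abstract
    rank : Carrier → ℕ
    rank x = suc (code x)

    rank-cong : ∀ {x y} → x ≈ y → rank x ≡ rank y
    rank-cong x≈y = cong (suc ∘ suc) (#.to-cong x≈y)

    ∈L-rank : ∀ x → x ∈L rank x
    ∈L-rank x = resp (e-code x) (e∈L ℕₚ.≤-refl)

  _≈?_ : ∀ x y → Dec (x ≈ y)
  x ≈? y = map′
    (λ eq → trans (sym (#.strictlyInverseʳ x))
              (trans (#.from-cong eq) (#.strictlyInverseʳ y)))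
    #.to-cong (#.to x ℕₚ.≟ #.to y)

  -- The order of L m, a numbering of its elements, and a decision of membership.
  module Layer (m : ℕ) where
    order : ℕ
    order = proj₁ (locallyFinite (applyUpTo e m))
    private module L = Inverse (proj₂ (locallyFinite (applyUpTo e m)))

    index : ∀ {x} → x ∈L m → Fin order
    index p = L.to (_ , p)

    index-injective : ∀ {x y} (p : x ∈L m) (q : y ∈L m) → index p ≡ index q → x ≈ y
    index-injective p q eq = trans (sym (L.strictlyInverseʳ (_ , p)))
      (trans (L.from-cong eq) (L.strictlyInverseʳ (_ , q)))

    ∈L? : Decidable (_∈L m)
    ∈L? x = map′
      (λ { (i , eq) → resp eq (proj₂ (L.from i)) })
      (λ p → L.to (x , p) , L.strictlyInverseʳ (x , p))
      (Finₚ.any? (λ i → proj₁ (L.from i) ≈? x))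

  open Layer public

  -- The i-th entry of the enumeration lies in the left coset x (L m).
  Reaches : ℕ → Carrier → ℕ → Set
  Reaches m x i = x ⁻¹ ∙ e i ∈L m

  -- The position of the leader of x (L m), its earliest entry.
  leading : ∀ m x → ∃[ d ] Least (Reaches m x) d
  leading m x = least (λ i → ∈L? m (x ⁻¹ ∙ e i)) (code x)
    (resp (sym (trans (∙-congˡ (e-code x)) (inverseˡ x))) unit)

  \\-cancel : ∀ x y z → (x ⁻¹ ∙ y) ∙ (y ⁻¹ ∙ z) ≈ x ⁻¹ ∙ z
  \\-cancel x y z = trans (assoc _ _ _) (∙-congˡ (\\-leftDividesˡ y z))

  ∈L-trans : ∀ {m} x y z → x ⁻¹ ∙ y ∈L m → y ⁻¹ ∙ z ∈L m → x ⁻¹ ∙ z ∈L m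
  ∈L-trans x y z p q = resp (\\-cancel x y z) (mul p q)

  ∈L-sym : ∀ {m} x y → x ⁻¹ ∙ y ∈L m → y ⁻¹ ∙ x ∈L m
  ∈L-sym x y p = resp (⁻¹-anti-homo-\\ x y) (inv p)

  digit : ℕ → Carrier → ℕ
  digit m x = proj₁ (leading m x)

  -- x divided on the left by its leader.
  remainder : ℕ → Carrier → Carrier
  remainder m x = e (digit m x) ⁻¹ ∙ x

  digit-coset : ∀ {m} x y → x ⁻¹ ∙ y ∈L m → digit m x ≡ digit m y
  digit-coset {m} x y p = Least-unique
    (λ {i} → ∈L-trans y x (e i) (∈L-sym x y p)) (λ {i} → ∈L-trans x y (e i) p)
    (proj₂ (leading m x)) (proj₂ (leading m y))

  digit-cong : ∀ m {x y} → x ≈ y → digit m x ≡ digit m y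
  digit-cong m {x} {y} x≈y =
    digit-coset x y (resp (trans (sym (inverseˡ x)) (∙-congˡ x≈y)) unit)

  -- Right multiplication by L m does not affect the coset, and hence the leader.
  digit-∙ : ∀ {m y} x → y ∈L m → digit m (x ∙ y) ≡ digit m x
  digit-∙ {m} {y} x y∈ =
    ≡.sym (digit-coset x (x ∙ y) (resp (sym (\\-leftDividesʳ x y)) y∈))

  -- The leader of L m is the identity because it heads the enumeration.
  digit-∈L : ∀ {m x} → x ∈L m → digit m x ≡ 0
  digit-∈L {m} {x} x∈ = Least-unique id id (proj₂ (leading m x))
    (resp (sym (identityʳ _)) (inv x∈) , λ ())

  remainder-∈L : ∀ m x → remainder m x ∈L m
  remainder-∈L m x = ∈L-sym x _ (proj₁ (proj₂ (leading m x)))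

  remainder-cong : ∀ m {x y} → x ≈ y → remainder m x ≈ remainder m y
  remainder-cong m x≈y =
    ∙-cong (⁻¹-cong (reflexive (cong e (digit-cong m x≈y)))) x≈y

  remainder-∙ : ∀ {m y} x → y ∈L m → remainder m (x ∙ y) ≈ remainder m x ∙ y
  remainder-∙ {m} {y} x y∈ = begin
    e (digit m (x ∙ y)) ⁻¹ ∙ (x ∙ y)
      ≡⟨ cong (λ d → e d ⁻¹ ∙ (x ∙ y)) (digit-∙ x y∈) ⟩
    e (digit m x) ⁻¹ ∙ (x ∙ y)
      ≈⟨ assoc _ _ _ ⟨
    remainder m x ∙ y ∎

  remainder-of-∈L : ∀ {m x} → x ∈L m → remainder m x ≈ x
  remainder-of-∈L {m} {x} x∈ = begin
    e (digit m x) ⁻¹ ∙ x  ≡⟨ cong (λ d → e d ⁻¹ ∙ x) (digit-∈L x∈) ⟩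
    ε ⁻¹ ∙ x              ≈⟨ ∙-congʳ ε⁻¹≈ε ⟩
    ε ∙ x                 ≈⟨ identityˡ x ⟩
    x                     ∎

  digit-remainder-injective : ∀ {m x y} → digit m x ≡ digit m y →
    remainder m x ≈ remainder m y → x ≈ y
  digit-remainder-injective {m} {x} {y} d≡ r≈ = ∙-cancelˡ (e (digit m x) ⁻¹) x y
    (trans r≈ (reflexive (cong (λ d → e d ⁻¹ ∙ y) (≡.sym d≡))))

  -- The remainder of x at level m, taken successively at the levels k + m - 1
  -- down to m.
  near : ℕ → ℕ → Carrier → Carrier
  near zero    m x = x
  near (suc k) m x = near k m (remainder (k + m) x)

  near-cong : ∀ k m {x y} → x ≈ y → near k m x ≈ near k m y
  near-cong zero    m x≈y = x≈y
  near-cong (suc k) m x≈y = near-cong k m (remainder-cong (k + m) x≈y)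

  near-∈L : ∀ k {m x} → x ∈L (k + m) → near k m x ∈L m
  near-∈L zero    x∈ = x∈
  near-∈L (suc k) {m} {x} _ = near-∈L k (remainder-∈L (k + m) x)

  near-∙ : ∀ k {m y} x → y ∈L m → near k m (x ∙ y) ≈ near k m x ∙ y
  near-∙ zero        x y∈ = refl
  near-∙ (suc k) {m} x y∈ = trans
    (near-cong k m (remainder-∙ x (L-up k y∈))) (near-∙ k _ y∈)

  -- The signs of the differences of the digits of x and y read on the way.
  block : ℕ → ℕ → Carrier → Carrier → List Sign
  block zero    m x y = []
  block (suc k) m x y = signs (digit (k + m) x) (digit (k + m) y)
                        ++ block k m (remainder (k + m) x) (remainder (k + m) y)

  block-cong : ∀ k m {x x′ y y′} → x ≈ x′ → y ≈ y′ → block k m x y ≡ block k m x′ y′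
  block-cong zero    m x≈ y≈ = ≡.refl
  block-cong (suc k) m x≈ y≈ = cong₂ _++_
    (cong₂ signs (digit-cong (k + m) x≈) (digit-cong (k + m) y≈))
    (block-cong k m (remainder-cong (k + m) x≈) (remainder-cong (k + m) y≈))

  block-∙ : ∀ k {m y y′} x x′ → y ∈L m → y′ ∈L m →
            block k m (x ∙ y) (x′ ∙ y′) ≡ block k m x x′
  block-∙ zero        x x′ y∈ y′∈ = ≡.refl
  block-∙ (suc k) {m} x x′ y∈ y′∈ = cong₂ _++_
    (cong₂ signs (digit-∙ x (L-up k y∈)) (digit-∙ x′ (L-up k y′∈)))
    (≡.trans (block-cong k m (remainder-∙ x (L-up k y∈)) (remainder-∙ x′ (L-up k y′∈)))
             (block-∙ k _ _ y∈ y′∈))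

  block-swap : ∀ k m x y → block k m y x ≡ map (Sign.- Sign.*_) (block k m x y)
  block-swap zero    m x y = ≡.refl
  block-swap (suc k) m x y = ≡.trans
    (cong₂ _++_ (signs-swap (digit (k + m) x) (digit (k + m) y)) (block-swap k m _ _))
    (≡.sym (map-++ (Sign.- Sign.*_) (signs (digit (k + m) x) (digit (k + m) y)) _))

  -- An element is determined by its digits down to level m and its remainder.
  block-injective : ∀ k m {x y} → block k m x y ≡ [] → near k m x ≈ near k m y → x ≈ y
  block-injective zero    m b n = n
  block-injective (suc k) m {x} {y} b n = digit-remainder-injective {k + m}
    (signs≡[] _ _ (++-conicalˡ (signs (digit (k + m) x) _) _ b))
    (block-injective k m (++-conicalʳ (signs (digit (k + m) x) (digit (k + m) y)) _ b) n)

  -- The signs of the differences of all the digits below level M.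
  sig : ℕ → Carrier → Carrier → List Sign
  sig zero    x y = []
  sig (suc m) x y = signs (digit m x) (digit m y) ++ sig m (remainder m x) (remainder m y)

  sig-cong : ∀ m {x x′ y y′} → x ≈ x′ → y ≈ y′ → sig m x y ≡ sig m x′ y′
  sig-cong zero    x≈ y≈ = ≡.refl
  sig-cong (suc m) x≈ y≈ = cong₂ _++_
    (cong₂ signs (digit-cong m x≈) (digit-cong m y≈))
    (sig-cong m (remainder-cong m x≈) (remainder-cong m y≈))

  sig-refl : ∀ m x → sig m x x ≡ []
  sig-refl zero    x = ≡.refl
  sig-refl (suc m) x = cong₂ _++_ (signs-refl _) (sig-refl m _)

  sig-split : ∀ k m x y → sig (k + m) x y ≡ block k m x y ++ sig m (near k m x) (near k m y)
  sig-split zero    m x y = ≡.refl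
  sig-split (suc k) m x y = ≡.trans
    (cong (signs (digit (k + m) x) (digit (k + m) y) ++_) (sig-split k m _ _))
    (≡.sym (++-assoc (signs (digit (k + m) x) (digit (k + m) y)) _ _))

  -- Elements of L m have the digit 0 at all higher levels.
  sig-stable : ∀ k {m x y} → x ∈L m → y ∈L m → sig (k + m) x y ≡ sig m x y
  sig-stable zero    x∈ y∈ = ≡.refl
  sig-stable (suc k) {m} {x} {y} x∈ y∈ = ≡.trans
    (cong₂ _++_
      (≡.trans (cong₂ signs (digit-∈L (L-up k x∈)) (digit-∈L (L-up k y∈))) (signs-refl 0))
      (sig-cong (k + m) (remainder-of-∈L (L-up k x∈)) (remainder-of-∈L (L-up k y∈))))
    (sig-stable k x∈ y∈)

  -- The number of sign changes between the digits of x and those of y.  A sign +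
  -- is put in front, so an initial - counts as a change.
  oscillation : Carrier → Carrier → ℕ
  oscillation x y = alternations Sign.+ (sig (rank x ⊔ rank y) x y)

  oscillation-cong : ∀ {x x′ y y′} → x ≈ x′ → y ≈ y′ → oscillation x y ≡ oscillation x′ y′
  oscillation-cong {x} {x′} {y} {y′} x≈ y≈ = cong (alternations Sign.+) (≡.trans
    (cong (λ r → sig r x y) (cong₂ _⊔_ (rank-cong x≈) (rank-cong y≈)))
    (sig-cong (rank x′ ⊔ rank y′) x≈ y≈))

  sig-high : ∀ M x y → sig (M + (rank x ⊔ rank y)) x y ≡ sig (rank x ⊔ rank y) x y
  sig-high M x y = sig-stable M
    (L-mono (ℕₚ.m≤m⊔n (rank x) (rank y)) (∈L-rank x))
    (L-mono (ℕₚ.m≤n⊔m (rank x) (rank y)) (∈L-rank y))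

-- Pairs of prescribed oscillation

bounded : ∀ {p} (g : Fin p → ℕ) → ∃[ k ] (∀ i → g i ≤ k)
bounded {zero}  g = 0 , λ ()
bounded {suc p} g with bounded (g ∘ Fin.suc)
... | k , g≤k = g Fin.zero ⊔ k , λ
  { Fin.zero    → ℕₚ.m≤m⊔n _ _
  ; (Fin.suc i) → ℕₚ.≤-trans (g≤k i) (ℕₚ.m≤n⊔m (g Fin.zero) k) }

-- The first of two things, or the second, according to a sign.
pick : ∀ {X : Set} → Sign → X → X → X
pick Sign.+ x y = x
pick Sign.- x y = y

module Oscillation
  (H : Grp) (countable : IsCountablyInfinite H) (locallyFinite : IsLocallyFinite H)
  (n : ℕ) (1<n : 1 < n) (F : GeneralizedDihedral.Tower n H) where

  open Group H
  open GroupProperties H using (∙-cancelˡ)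
  open Digits H countable locallyFinite
  open GeneralizedDihedral n
  open Tower F

  -- The element of the abelian part with given exponents.
  f : ℕ → Exponents → Carrier
  f N u = Emb.to (stage N) (u , Sign.+)

  f-⊕ : ∀ N u v → f N (u ⊕ v) ≈ f N u ∙ f N v
  f-⊕ N u v = Embedding.homo (stage N) (u , Sign.+) (v , Sign.+)

  -- The outcome of ordering r pairs of candidates above level m: exponents u and v
  -- below N for the two products, involving only generators from N₀ on.  Whatever
  -- factors y and y′ from L m are appended to the products, the signs noted at
  -- levels m and above are those in upper, which have c alternations, and ν is the
  -- remainder of both products at level m.  No signs are noted at levels M and
  -- above.
  record Selection (r m N₀ : ℕ) (ν : Carrier) (c : ℕ) : Set where
    field
      {N}       : ℕ
      u v       : Exponents
      N₀≤N      : N₀ ≤ N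
      u-fresh   : ∀ {i} → i < N₀ → u i ≡ + 0
      v-fresh   : ∀ {i} → i < N₀ → v i ≡ + 0
      separated : r ≡ 0 ⊎ Separated N u v
      upper     : List Sign
      count     : alternations Sign.+ upper ≡ c
      M         : ℕ
      sig-upper : ∀ k {y y′} → y ∈L m → y′ ∈L m →
        sig (k + M) (f N u ∙ y) (f N v ∙ y′) ≡ upper ++ sig m (ν ∙ y) (ν ∙ y′)

  oscillation-selected : ∀ {r N₀ m ν c τ} → τ ∈L m → (sel : Selection r m N₀ ν c) →
    let open Selection sel in oscillation (f N u ∙ τ) (f N v ∙ τ) ≡ c
  oscillation-selected {m = m} {ν} {c} {τ} τ∈L sel =
    ≡.trans (cong (alternations Sign.+) (≡.trans (≡.sym (sig-high M x y)) (sig≡ _))) count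
    where
    open Selection sel
    x y : Carrier
    x = f N u ∙ τ
    y = f N v ∙ τ
    open ≡.≡-Reasoning
    sig≡ : ∀ R → sig (M + R) x y ≡ upper
    sig≡ R = begin
      sig (M + R) x y                 ≡⟨ cong (λ l → sig l x y) (ℕₚ.+-comm M R) ⟩
      sig (R + M) x y                 ≡⟨ sig-upper R τ∈L τ∈L ⟩
      upper ++ sig m (ν ∙ τ) (ν ∙ τ)  ≡⟨ cong (upper ++_) (sig-refl m _) ⟩
      upper ++ []                     ≡⟨ ++-identityʳ upper ⟩
      upper                           ∎

  -- Selections with the same remainder ν and with base, base + 1, …, base + r
  -- alternations.
  record Spread (r m N₀ : ℕ) : Set where
    field
      ν      : Carrier
      ν∈L    : ν ∈L m
      base   : ℕ
      select : ∀ t → t ≤ r → Selection r m N₀ ν (base + t)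

  spread-zero : ∀ m N₀ → Spread 0 m N₀
  spread-zero m N₀ = record
    { ν = ε ; ν∈L = unit ; base = 0
    ; select = λ { .0 z≤n → record
      { u = 𝟘 ; v = 𝟘 ; N₀≤N = ℕₚ.≤-refl ; u-fresh = λ _ → ≡.refl ; v-fresh = λ _ → ≡.refl
      ; separated = inj₁ ≡.refl ; upper = [] ; count = ≡.refl ; M = m
      ; sig-upper = λ k y∈ y′∈ → ≡.trans
          (sig-cong (k + m) (∙-congʳ f𝟘≈ε) (∙-congʳ f𝟘≈ε))
          (sig-stable k (mul unit y∈) (mul unit y′∈))
      } }
    }
    where
    f𝟘≈ε : f N₀ 𝟘 ≈ ε
    f𝟘≈ε = Embedding.ε-homo (stage N₀)

  -- One further pair, between level m and the selections made above.
  module Step (r m N₀ : ℕ) where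

    -- One more candidate than L m has elements, so that two remainders collide.  The
    -- candidates are the generators with indices from N₀ to N₁ - 1.
    pool : ℕ
    pool = suc (order m)

    N₁ : ℕ
    N₁ = N₀ + pool

    place : Fin pool → ℕ
    place i = N₀ + toℕ i

    place<N₁ : ∀ i → place i < N₁
    place<N₁ i = ℕₚ.+-monoʳ-< N₀ (Finₚ.toℕ<n i)

    place-injective : ∀ {i j} → place i ≡ place j → i ≡ j
    place-injective eq = Finₚ.toℕ-injective (ℕₚ.+-cancelˡ-≡ N₀ _ _ eq)

    z : Fin pool → Carrier
    z i = f N₁ (δ (place i))

    z-coherent : ∀ {N} i → N₁ ≤ N → f N (δ (place i)) ≈ z i
    z-coherent {N} i N₁≤N = ≡.subst (λ N → f N (δ (place i)) ≈ z i) (ℕₚ.m∸n+n≡m N₁≤N)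
      (coherent-≤ (N ℕ.∸ N₁) N₁ (δ (place i)) Sign.+ λ j N₁≤j →
        δ-off-diagonal (place i) j (λ { ≡.refl → ℕₚ.<⇒≱ (place<N₁ i) N₁≤j }))

    z-distinct : ∀ {i j} → i ≢ j → ¬ z i ≈ z j
    z-distinct {i} {j} i≢j eq = contradiction n∣1 (ℕ∣.>⇒∤ 1<n)
      where
      1≡0 : + 1 ≡ + 0 [mod n ]
      1≡0 = ≡.subst₂ _≡_[mod n ] (δ-diagonal (place i))
        (δ-off-diagonal (place j) (place i) (i≢j ∘ ≡.sym ∘ place-injective))
        (proj₁ (Embedding.injective (stage N₁) {δ (place i) , Sign.+} {δ (place j) , Sign.+} eq)
          (place i) (place<N₁ i))
      n∣1 : n ℕ∣.∣ 1
      n∣1 = ∣⇒∣ᵤ 1≡0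

    -- All candidates lie in L (k + m).
    k : ℕ
    k = proj₁ (bounded (rank ∘ z))

    z∈L : ∀ i → z i ∈L (k + m)
    z∈L i = L-mono (ℕₚ.≤-trans (proj₂ (bounded (rank ∘ z)) i) (ℕₚ.m≤m+n k m)) (∈L-rank (z i))

    module _ (above : Spread r (k + m) N₁) where
      private module A = Spread above

      near-z : ∀ i → near k m (A.ν ∙ z i) ∈L m
      near-z i = near-∈L k (mul A.ν∈L (z∈L i))

      collision : ∃[ i ] ∃[ j ] i Fin.< j × index m (near-z i) ≡ index m (near-z j)
      collision = Finₚ.pigeonhole ℕₚ.≤-refl (λ i → index m (near-z i))

      i j : Fin pool
      i = proj₁ collision
      j = proj₁ (proj₂ collision)

      i≢j : i ≢ j
      i≢j = Finₚ.<⇒≢ (proj₁ (proj₂ (proj₂ collision)))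

      -- The common remainder, whichever of the two candidates follows A.ν.
      ν : Carrier
      ν = near k m (A.ν ∙ z i)

      near-i≈j : ν ≈ near k m (A.ν ∙ z j)
      near-i≈j = index-injective m (near-z i) (near-z j) (proj₂ (proj₂ (proj₂ collision)))

      near-pick : ∀ θ → near k m (A.ν ∙ z (pick θ i j)) ≈ ν
      near-pick Sign.+ = refl
      near-pick Sign.- = sym near-i≈j

      -- The signs noted between the levels k + m and m if the i-th candidate goes
      -- into the first product and the j-th into the second.
      Δ : List Sign
      Δ = block k m (A.ν ∙ z i) (A.ν ∙ z j)

      block-pick : ∀ θ → block k m (A.ν ∙ z (pick θ i j)) (A.ν ∙ z (pick θ j i))
                         ≡ map (θ Sign.*_) Δ
      block-pick Sign.+ = ≡.sym (map-id Δ)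
      block-pick Sign.- = block-swap k m _ _

      Δ≢[] : Δ ≢ []
      Δ≢[] Δ≡[] = z-distinct i≢j (∙-cancelˡ A.ν _ _ (block-injective k m Δ≡[] near-i≈j))

      near-pick′ : ∀ θ → near k m (A.ν ∙ z (pick θ j i)) ≈ ν
      near-pick′ Sign.+ = sym near-i≈j
      near-pick′ Sign.- = refl

      below : ∀ p {y} → near k m (A.ν ∙ z p) ≈ ν → y ∈L m → near k m (A.ν ∙ (z p ∙ y)) ≈ ν ∙ y
      below p {y} eq y∈ = trans (near-cong k m (sym (assoc _ _ _)))
        (trans (near-∙ k _ y∈) (∙-congʳ eq))

      -- Put the two candidates, in the order given by θ, below a selection.
      glue : ∀ {c c′} (sel : Selection r (k + m) N₁ A.ν c) θ →
        alternations (lastSign Sign.+ (Selection.upper sel)) (map (θ Sign.*_) Δ) ≡ c′ →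
        Selection (suc r) m N₀ ν (c + c′)
      glue {c} {c′} sel θ alt = record
        { N         = S.N
        ; u         = S.u ⊕ δ (place p)
        ; v         = S.v ⊕ δ (place q)
        ; N₀≤N      = ℕₚ.≤-trans (ℕₚ.m≤m+n N₀ pool) S.N₀≤N
        ; u-fresh   = fresh S.u S.u-fresh p
        ; v-fresh   = fresh S.v S.v-fresh q
        ; separated = inj₂ (place i , ℕₚ.<-≤-trans (place<N₁ i) S.N₀≤N , differ θ)
        ; upper     = S.upper ++ map (θ Sign.*_) Δ
        ; count     = ≡.trans (alternations-++ Sign.+ S.upper _) (cong₂ _+_ S.count alt)
        ; M         = S.M
        ; sig-upper = sig-upper
        }
        where
        module S = Selection sel
        p q : Fin pool
        p = pick θ i j
        q = pick θ j i

        fresh : ∀ u → (∀ {l} → l < N₁ → u l ≡ + 0) → ∀ p {l} → l < N₀ →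
                (u ⊕ δ (place p)) l ≡ + 0
        fresh u u-fresh p {l} l<N₀ = cong₂ ℤ._+_ (u-fresh (ℕₚ.<-≤-trans l<N₀ (ℕₚ.m≤m+n N₀ pool)))
          (δ-off-diagonal (place p) l λ { ≡.refl → ℕₚ.<⇒≱ l<N₀ (ℕₚ.m≤m+n N₀ (toℕ p)) })

        at-i : ∀ θ → (S.u ⊕ δ (place (pick θ i j))) (place i) ≡ pick θ (+ 1) (+ 0)
        at-i Sign.+ = cong₂ ℤ._+_ (S.u-fresh (place<N₁ i)) (δ-diagonal (place i))
        at-i Sign.- = cong₂ ℤ._+_ (S.u-fresh (place<N₁ i))
          (δ-off-diagonal (place j) (place i) (i≢j ∘ ≡.sym ∘ place-injective))

        at-i′ : ∀ θ → (S.v ⊕ δ (place (pick θ j i))) (place i) ≡ pick θ (+ 0) (+ 1)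
        at-i′ Sign.+ = cong₂ ℤ._+_ (S.v-fresh (place<N₁ i))
          (δ-off-diagonal (place j) (place i) (i≢j ∘ ≡.sym ∘ place-injective))
        at-i′ Sign.- = cong₂ ℤ._+_ (S.v-fresh (place<N₁ i)) (δ-diagonal (place i))

        differ : ∀ θ →
          let d = (S.v ⊕ δ (place (pick θ j i))) (place i)
                  ℤ.- (S.u ⊕ δ (place (pick θ i j))) (place i)
          in d ≡ + 1 ⊎ d ≡ ℤ.- + 1
        differ Sign.+ = inj₂ (cong₂ ℤ._-_ (at-i′ Sign.+) (at-i Sign.+))
        differ Sign.- = inj₁ (cong₂ ℤ._-_ (at-i′ Sign.-) (at-i Sign.-))

        split : ∀ u p {y} → f S.N (u ⊕ δ (place p)) ∙ y ≈ f S.N u ∙ (z p ∙ y)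
        split u p = trans (∙-congʳ (trans (f-⊕ S.N u _) (∙-congˡ (z-coherent p S.N₀≤N))))
                          (assoc _ _ _)

        sig-upper : ∀ K {y y′} → y ∈L m → y′ ∈L m →
          sig (K + S.M) (f S.N (S.u ⊕ δ (place p)) ∙ y) (f S.N (S.v ⊕ δ (place q)) ∙ y′)
          ≡ (S.upper ++ map (θ Sign.*_) Δ) ++ sig m (ν ∙ y) (ν ∙ y′)
        sig-upper K {y} {y′} y∈ y′∈ = begin
          sig (K + S.M) (f S.N (S.u ⊕ δ (place p)) ∙ y) (f S.N (S.v ⊕ δ (place q)) ∙ y′)
            ≡⟨ sig-cong (K + S.M) (split S.u p) (split S.v q) ⟩
          sig (K + S.M) (f S.N S.u ∙ (z p ∙ y)) (f S.N S.v ∙ (z q ∙ y′))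
            ≡⟨ S.sig-upper K (mul (z∈L p) (L-up k y∈)) (mul (z∈L q) (L-up k y′∈)) ⟩
          S.upper ++ sig (k + m) (A.ν ∙ (z p ∙ y)) (A.ν ∙ (z q ∙ y′))
            ≡⟨ cong (S.upper ++_) (sig-split k m _ _) ⟩
          S.upper ++ block k m (A.ν ∙ (z p ∙ y)) (A.ν ∙ (z q ∙ y′))
                  ++ sig m (near k m (A.ν ∙ (z p ∙ y))) (near k m (A.ν ∙ (z q ∙ y′)))
            ≡⟨ cong₂ (λ l l′ → S.upper ++ l ++ l′)
                 (≡.trans (block-cong k m (sym (assoc _ _ _)) (sym (assoc _ _ _)))
                   (≡.trans (block-∙ k _ _ y∈ y′∈) (block-pick θ)))
                 (sig-cong m (below p (near-pick θ) y∈) (below q (near-pick′ θ) y′∈)) ⟩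
          S.upper ++ map (θ Sign.*_) Δ ++ sig m (ν ∙ y) (ν ∙ y′)
            ≡⟨ ++-assoc S.upper _ _ ⟨
          (S.upper ++ map (θ Sign.*_) Δ) ++ sig m (ν ∙ y) (ν ∙ y′) ∎
          where open ≡.≡-Reasoning

      -- The sign changes within Δ do not depend on the order of the pair, and are
      -- added to the base.
      extended : ∀ d Δ′ → Δ ≡ d ∷ Δ′ → Spread (suc r) m N₀
      extended d Δ′ Δ≡ = record
        { ν      = ν
        ; ν∈L    = near-z i
        ; base   = A.base + alternations d Δ′
        ; select = select
        }
        where
        -- Choose the order for which the boundary between the signs of the selection
        -- and those below contributes b sign changes.
        turn : ∀ {c} (sel : Selection r (k + m) N₁ A.ν c) b →
               (∀ s → ∃[ σ ] change s σ ≡ b) →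
               Selection (suc r) m N₀ ν (c + (b + alternations d Δ′))
        turn sel b choose = glue sel (proj₁ scaled)
          (≡.trans (cong (alternations s ∘ map (proj₁ scaled Sign.*_)) Δ≡)
            (≡.trans (proj₂ scaled)
              (cong (_+ alternations d Δ′) (proj₂ (choose s)))))
          where
          s = lastSign Sign.+ (Selection.upper sel)
          scaled = alternations-scaled s (proj₁ (choose s)) d Δ′

        stay : ∀ s → ∃[ σ ] change s σ ≡ 0
        stay Sign.+ = Sign.+ , ≡.refl
        stay Sign.- = Sign.- , ≡.refl

        flip : ∀ s → ∃[ σ ] change s σ ≡ 1
        flip Sign.+ = Sign.- , ≡.refl
        flip Sign.- = Sign.+ , ≡.refl

        select : ∀ t → t ≤ suc r → Selection (suc r) m N₀ ν ((A.base + alternations d Δ′) + t)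
        select zero    _         = ≡.subst (Selection (suc r) m N₀ ν)
          (rearrange A.base (alternations d Δ′))
          (turn (A.select 0 z≤n) 0 stay)
          where
          rearrange : ∀ b a → (b + 0) + (0 + a) ≡ (b + a) + 0
          rearrange = ℕ-Solver.solve-∀
        select (suc t) (s≤s t≤r) = ≡.subst (Selection (suc r) m N₀ ν)
          (rearrange A.base (alternations d Δ′) t)
          (turn (A.select t t≤r) 1 flip)
          where
          rearrange : ∀ b a t → (b + t) + (1 + a) ≡ (b + a) + (1 + t)
          rearrange = ℕ-Solver.solve-∀

      step : Spread (suc r) m N₀
      step with Δ in eq
      ... | []     = contradiction eq Δ≢[]
      ... | d ∷ Δ′ = extended d Δ′ eq

  spread : ∀ r m N₀ → Spread r m N₀
  spread zero    m N₀ = spread-zero m N₀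
  spread (suc r) m N₀ = Step.step r m N₀ (spread r (Step.k r m N₀ + m) (Step.N₁ r m N₀))

-- The colouring takes all values

-- Any p + 1 consecutive numbers represent all residues modulo p + 1.
hit-residue : ∀ p base (c : Fin (suc p)) → ∃[ t ] t ≤ p × (base + t) mod suc p ≡ c
hit-residue p base c = t , ℕₚ.<⇒≤pred (m%n<n x (suc p)) , Finₚ.toℕ-injective (begin
  toℕ ((base + t) mod suc p)                    ≡⟨ Finₚ.toℕ-fromℕ< _ ⟩
  (base + t) % suc p                            ≡⟨ %-distribˡ-+ base t (suc p) ⟩
  (base % suc p + t % suc p) % suc p            ≡⟨ cong (λ y → (base % suc p + y) % suc p)
                                                        (m%n%n≡m%n x (suc p)) ⟩
  (base % suc p + x % suc p) % suc p            ≡⟨ %-distribˡ-+ base x (suc p) ⟨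
  (base + x) % suc p                            ≡⟨ cong (_% suc p) (rearrange base (toℕ c) p) ⟩
  (toℕ c + base * suc p) % suc p                ≡⟨ [m+kn]%n≡m%n (toℕ c) base (suc p) ⟩
  toℕ c % suc p                                 ≡⟨ m<n⇒m%n≡m (Finₚ.toℕ<n c) ⟩
  toℕ c                                         ∎)
  where
  open ≡.≡-Reasoning
  -- x is congruent to c - base modulo p + 1.
  x t : ℕ
  x = toℕ c + base * p
  t = x % suc p
  rearrange : ∀ b c p → b + (c + b * p) ≡ c + b * (1 + p)
  rearrange = ℕ-Solver.solve-∀

module _ {H G : Grp} (hall : IsHallUniversal H) (G-finite : IsFinite G)
         {n : ℕ} (1<n : 1 < n) (ι : Emb (D n) G) where
  open IsHallUniversal hall using (countable; locallyFinite)
  open Group H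
  open Digits H countable locallyFinite
  open GeneralizedDihedral n

  private
    instance
      n≢0 : NonZero n
      n≢0 = ℕ.>-nonZero (ℕₚ.<-trans z<s 1<n)

    -- The images in G of two reflections generating D n.
    a b : Group.Carrier G
    a = Emb.to ι (+ 0 , Sign.-)
    b = Emb.to ι (+ 1 , Sign.-)

  -- For any w, every residue modulo p + 1 is attained by the oscillation of the
  -- images of a and b under w ∘ h for some embedding h of G.
  module Everywhere (E : Tower H) (w : Emb H H) (p : ℕ) (1≤p : 1 ≤ p) where
    F : Tower H
    F = push w E
    open Tower F

    -- The image under w of the element that inverts the exponents.
    τ : Carrier
    τ = Emb.to (stage 0) (𝟘 , Sign.-)

    stage-τ : ∀ N → Emb.to (stage N) (𝟘 , Sign.-) ≈ τ
    stage-τ N = ≡.subst (λ N → Emb.to (stage N) (𝟘 , Sign.-) ≈ τ) (ℕₚ.+-identityʳ N)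
      (coherent-≤ N 0 𝟘 Sign.- (λ _ _ → ≡.refl))

    open Oscillation H countable locallyFinite n 1<n F

    stage-reflection : ∀ N {u u′} → (∀ j → u′ j ≡ u j) →
      Emb.to (stage N) (u′ , Sign.-) ≈ f N u ∙ τ
    stage-reflection N {u} {u′} u′≡u = trans
      (Embedding.to-cong (stage N) {u′ , Sign.-} {(λ j → u j ℤ.+ + 0) , Sign.-}
        ((λ j _ → Mod.≡⇒ n (≡.trans (u′≡u j) (≡.sym (ℤₚ.+-identityʳ (u j))))) , ≡.refl))
      (trans (Embedding.homo (stage N) (u , Sign.+) (𝟘 , Sign.-)) (∙-congˡ (stage-τ N)))

    -- The embedding of G obtained from a selection.
    realize : ∀ {m N₀ ν c} → τ ∈L m → Selection p m N₀ ν c →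
      Σ[ h ∈ Emb G H ] oscillation (Emb.to (w ∘ₑ h) a) (Emb.to (w ∘ₑ h) b) ≡ c
    realize τ∈L sel = h , ≡.trans (oscillation-cong
      (at (+ 0) (word-0 Sel.u Sel.v)) (at (+ 1) (word-1 Sel.u Sel.v)))
      (oscillation-selected τ∈L sel)
      where
      module Sel = Selection sel
      separated : Separated Sel.N Sel.u Sel.v
      separated with Sel.separated
      ... | inj₁ p≡0 = contradiction p≡0 (ℕₚ.>⇒≢ 1≤p)
      ... | inj₂ sep = sep
      extended = extend hall (D-finite n) G-finite ι
        (Tower.stage E Sel.N ∘ₑ reflections Sel.u Sel.v separated)
      h : Emb G H
      h = proj₁ extended
      at : ∀ i {u} → (∀ j → word Sel.u Sel.v i Sign.- j ≡ u j) →
           Emb.to (w ∘ₑ h) (Emb.to ι (i , Sign.-)) ≈ f Sel.N u ∙ τ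
      at i word≡u = trans (Embedding.to-cong w (proj₂ extended (i , Sign.-)))
        (stage-reflection Sel.N word≡u)

    every-residue : ∀ c → Σ[ h ∈ Emb G H ]
      oscillation (Emb.to (w ∘ₑ h) a) (Emb.to (w ∘ₑ h) b) mod suc p ≡ c
    every-residue c =
      let open Spread (spread p (rank τ) 0)
          t , t≤p , base+t≡c = hit-residue p base c
          h , oscillation≡   = realize (∈L-rank τ) (select t t≤p)
      in h , ≡.trans (cong (_mod suc p) oscillation≡) base+t≡c

  -- All p + 1 colours survive under any w, so p of them do not suffice.
  contains-D⇒T≡∞ : T[ G , H ]≡∞
  contains-D⇒T≡∞ (p , 1≤p , bound) with bound (suc p) (s≤s z≤n) χ
    where
    χ : Func (EmbSetoid G H) (≡.setoid (Fin (suc p)))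
    χ = record
      { to   = λ h → oscillation (Emb.to h a) (Emb.to h b) mod suc p
      ; cong = λ h≈h′ → cong (_mod suc p) (oscillation-cong (h≈h′ a) (h≈h′ b))
      }
  ... | w , colours , ∣colours∣≤p , inside = ℕₚ.<⇒≱ ℕₚ.≤-refl
    (ℕₚ.≤-trans (≡.subst (_≤ Subset.∣ colours ∣) (∣⊤∣≡n (suc p)) (p⊆q⇒∣p∣≤∣q∣ all-colours))
                ∣colours∣≤p)
    where
    all-colours : ⊤ ⊆ colours
    all-colours {c} _ =
      let h , eq = Everywhere.every-residue (Hall-tower hall) w p 1≤p c
      in ≡.subst (_∈ colours) eq (inside h)

-- Dihedral subgroups of direct products

-- Negation is trivial modulo 2, so D 2 is a direct product.
C₂²-Emb : Emb (D 2) (C 2 ×ᴳ C 2)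
C₂²-Emb = embedding (D 2) (C 2 ×ᴳ C 2)
  (λ { (i , s) → i , bit s })
  (λ { {_ , s} (p , ≡.refl) → p , ≡⇒ {bit s} ≡.refl })
  (λ { (i , s) (j , t) → twist s i j , bit-homo s t })
  (λ { (i , Sign.+) (p , _) → p , ≡.refl
     ; (i , Sign.-) (_ , q) → contradiction (∣⇒∣ᵤ q) (ℕ∣.>⇒∤ ℕₚ.≤-refl) })
  where
  open Mod 2
  bit : Sign → ℤ
  bit Sign.+ = + 0
  bit Sign.- = + 1
  bit-homo : ∀ s t → bit (s Sign.* t) ≡ bit s ℤ.+ bit t [mod 2 ]
  bit-homo Sign.+ t      = ≡⇒ (≡.sym (ℤₚ.+-identityˡ (bit t)))
  bit-homo Sign.- Sign.+ = ≡⇒ {+ 1} ≡.refl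
  bit-homo Sign.- Sign.- = divides (ℤ.- + 1) ≡.refl
  twist : ∀ s i j → i ℤ.+ s · j ≡ i ℤ.+ j [mod 2 ]
  twist Sign.+ i j = ≡⇒ {i ℤ.+ j} ≡.refl
  twist Sign.- i j = divides (ℤ.- j) (lemma i j)
    where
    lemma : ∀ i j → (i ℤ.- j) ℤ.- (i ℤ.+ j) ≡ (ℤ.- j) ℤ.* + 2
    lemma = ℤ-Solver.solve-∀

-- A family of integers as an element of a product of cyclic groups.
tuple : ∀ {k} (ns : Vec ℕ k) → (Fin k → ℤ) → Group.Carrier (∏C ns)
tuple []       f = _
tuple (n ∷ ns) f = f Fin.zero , tuple ns (f ∘ Fin.suc)

tuple-cong : ∀ {k} (ns : Vec ℕ k) {f g} → (∀ i → f i ≡ g i [mod lookup ns i ]) →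
             Group._≈_ (∏C ns) (tuple ns f) (tuple ns g)
tuple-cong []       p = _
tuple-cong (n ∷ ns) p = p Fin.zero , tuple-cong ns (p ∘ Fin.suc)

tuple-injective : ∀ {k} (ns : Vec ℕ k) {f g} →
  Group._≈_ (∏C ns) (tuple ns f) (tuple ns g) → ∀ i → f i ≡ g i [mod lookup ns i ]
tuple-injective (n ∷ ns) (p , _) Fin.zero    = p
tuple-injective (n ∷ ns) (_ , q) (Fin.suc i) = tuple-injective ns q i

tuple-∙ : ∀ {k} (ns : Vec ℕ k) f g →
  Group._≈_ (∏C ns) (tuple ns (λ i → f i ℤ.+ g i)) (Group._∙_ (∏C ns) (tuple ns f) (tuple ns g))
tuple-∙ []       f g = _
tuple-∙ (n ∷ ns) f g = Mod.≡⇒ n {f Fin.zero ℤ.+ g Fin.zero} ≡.refl , tuple-∙ ns _ _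

tuple-ε : ∀ {k} (ns : Vec ℕ k) → Group._≈_ (∏C ns) (tuple ns (λ _ → + 0)) (Group.ε (∏C ns))
tuple-ε []       = _
tuple-ε (n ∷ ns) = Mod.≡⇒ n {+ 0} ≡.refl , tuple-ε ns

∏C-finite : ∀ {k} (ns : Vec ℕ k) → (∀ i → 1 ≤ lookup ns i) → IsFinite (∏C ns)
∏C-finite []       _  = Finite-trivial _ _
∏C-finite (n ∷ ns) 1≤ =
  Finite-× (C-finite n {{ℕ.>-nonZero (1≤ Fin.zero)}}) (∏C-finite ns (1≤ ∘ Fin.suc))

-- Multiplication by h embeds the cyclic group of order 2 in that of order 2h.
half-cong : ∀ h {i j} → i ≡ j [mod 2 ] → i ℤ.* + h ≡ j ℤ.* + h [mod h * 2 ]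
half-cong h {i} {j} (divides q eq) = divides q (≡.trans (expand i j (+ h))
  (≡.trans (cong (ℤ._* + h) eq)
    (≡.trans (collect q (+ h)) (cong (q ℤ.*_) (≡.sym (ℤₚ.pos-* h 2))))))
  where
  expand : ∀ i j h → i ℤ.* h ℤ.- j ℤ.* h ≡ (i ℤ.- j) ℤ.* h
  expand = ℤ-Solver.solve-∀
  collect : ∀ q h → (q ℤ.* + 2) ℤ.* h ≡ q ℤ.* (h ℤ.* + 2)
  collect = ℤ-Solver.solve-∀

half-injective : ∀ h .{{_ : NonZero h}} {i} → i ℤ.* + h ≡ + 0 [mod h * 2 ] → i ≡ + 0 [mod 2 ]
half-injective h {i} p = ≡.subst (+ 2 ℤ∣.∣_) (≡.sym (ℤₚ.+-identityʳ i))
  (∣ᵤ⇒∣ (ℕ∣.*-cancelʳ-∣ h (≡.subst₂ _∣_ (ℕₚ.*-comm h 2)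
    (≡.trans (cong ℤ.∣_∣ (ℤₚ.+-identityʳ (i ℤ.* + h))) (ℤₚ.abs-* i (+ h))) (∣⇒∣ᵤ p))))

∏C-Emb : ∀ {k} (ns : Vec ℕ k) → (∀ i → 1 ≤ lookup ns i) →
  ∀ {i j} → i ≢ j → 2 ∣ lookup ns i → 2 ∣ lookup ns j → Emb (C 2 ×ᴳ C 2) (∏C ns)
∏C-Emb {k} ns 1≤ {i} {j} i≢j (ℕ∣.divides h h≡) (ℕ∣.divides h′ h′≡) =
  embedding (C 2 ×ᴳ C 2) (∏C ns) (λ x → tuple ns (λ l → entry l x))
    (λ x≈y → tuple-cong ns (λ l → entry-cong l x≈y))
    (λ x y → Group.trans (∏C ns) (tuple-cong ns (λ l → Mod.≡⇒ (lookup ns l) (entry-homo l x y)))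
                                 (tuple-∙ ns _ _))
    (λ x eq → kernel x (tuple-injective ns
      (Group.trans (∏C ns) eq (Group.sym (∏C ns) (tuple-ε ns)))))
  where
  -- The element (a , b) has the entry a (nᵢ/2) at i, b (nⱼ/2) at j, and 0 elsewhere.
  entry : Fin k → ℤ × ℤ → ℤ
  entry l (a , b) with l Finₚ.≟ i | l Finₚ.≟ j
  ... | yes _ | _     = a ℤ.* + h
  ... | no _  | yes _ = b ℤ.* + h′
  ... | no _  | no _  = + 0

  entry-cong : ∀ l {x y} → Group._≈_ (C 2 ×ᴳ C 2) x y → entry l x ≡ entry l y [mod lookup ns l ]
  entry-cong l {a , b} {a′ , b′} (p , q) with l Finₚ.≟ i | l Finₚ.≟ j
  ... | yes ≡.refl | _          =
    ≡.subst (a ℤ.* + h ≡ a′ ℤ.* + h [mod_]) (≡.sym h≡) (half-cong h {a} {a′} p)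
  ... | no _       | yes ≡.refl =
    ≡.subst (b ℤ.* + h′ ≡ b′ ℤ.* + h′ [mod_]) (≡.sym h′≡) (half-cong h′ {b} {b′} q)
  ... | no _       | no _       = Mod.≡⇒ (lookup ns l) {+ 0} ≡.refl

  entry-homo : ∀ l x y → entry l (Group._∙_ (C 2 ×ᴳ C 2) x y) ≡ entry l x ℤ.+ entry l y
  entry-homo l (a , b) (a′ , b′) with l Finₚ.≟ i | l Finₚ.≟ j
  ... | yes _ | _     = ℤₚ.*-distribʳ-+ (+ h) a a′
  ... | no _  | yes _ = ℤₚ.*-distribʳ-+ (+ h′) b b′
  ... | no _  | no _  = ≡.refl

  entry-i : ∀ x → entry i x ≡ proj₁ x ℤ.* + h
  entry-i x with i Finₚ.≟ i | i Finₚ.≟ j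
  ... | yes _  | _ = ≡.refl
  ... | no i≢i | _ = contradiction ≡.refl i≢i

  entry-j : ∀ x → entry j x ≡ proj₂ x ℤ.* + h′
  entry-j x with j Finₚ.≟ i | j Finₚ.≟ j
  ... | yes j≡i | _      = contradiction (≡.sym j≡i) i≢j
  ... | no _    | yes _  = ≡.refl
  ... | no _    | no j≢j = contradiction ≡.refl j≢j

  nonZero : ∀ l h → lookup ns l ≡ h * 2 → NonZero h
  nonZero l zero    eq = contradiction eq (ℕₚ.>⇒≢ (1≤ l))
  nonZero l (suc h) eq = _

  kernel : ∀ x → (∀ l → entry l x ≡ + 0 [mod lookup ns l ]) →
           Group._≈_ (C 2 ×ᴳ C 2) x (+ 0 , + 0)
  kernel x p =
      half-injective h {{nonZero i h h≡}} {proj₁ x}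
        (≡.subst₂ (_≡ + 0 [mod_]) (entry-i x) h≡ (p i))
    , half-injective h′ {{nonZero j h′ h′≡}} {proj₂ x}
        (≡.subst₂ (_≡ + 0 [mod_]) (entry-j x) h′≡ (p j))

-- Symmetric groups

-- A permutation of suc n points is the image of the point zero together with a
-- permutation of n points.
Sym-finite : ∀ n → IsFinite (Sym n)
Sym-finite zero    = Finite-trivial Perm.id (λ _ ())
Sym-finite (suc n) = Finite-≅ {T = ≡.setoid (Fin (suc n)) ×ₛ Group.setoid (Sym n)} (record
  { to        = λ π → π ⟨$⟩ʳ Fin.zero , remove Fin.zero π
  ; from      = λ { (i , π) → insert Fin.zero i π }
  ; to-cong   = λ {π} {ρ} π≈ρ → π≈ρ Fin.zero , remove-cong π ρ π≈ρ
  ; from-cong = λ { {i , π} {.i , ρ} (≡.refl , π≈ρ) → insert-cong i π ρ π≈ρ }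
  ; inverse   =
      (λ { {i , π} {ρ} p → p Fin.zero , λ k →
           ≡.trans (remove-cong ρ (insert Fin.zero i π) p k) (remove-insert Fin.zero i π k) })
    , (λ { {π} {_ , ρ} (≡.refl , p) k →
           ≡.trans (insert-cong (π ⟨$⟩ʳ Fin.zero) ρ (remove Fin.zero π) p k)
                   (insert-remove Fin.zero π k) })
  }) (Finite-× (Finite-Fin (suc n)) (Sym-finite n))
  where
  insert-cong : ∀ i (π ρ : Permutation′ n) → π Perm.≈ ρ →
                insert Fin.zero i π Perm.≈ insert Fin.zero i ρ
  insert-cong i π ρ p Fin.zero = ≡.refl
  insert-cong i π ρ p (Fin.suc k) = cong (Fin.punchIn i) (p k)
  remove-cong : ∀ (π ρ : Permutation′ (suc n)) → π Perm.≈ ρ →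
                remove Fin.zero π Perm.≈ remove Fin.zero ρ
  remove-cong π ρ p k = Finₚ.punchIn-injective (π ⟨$⟩ʳ Fin.zero) _ _ (≡.trans
    (≡.sym (Perm.punchIn-permute π Fin.zero k))
    (≡.trans (p (Fin.suc k)) (≡.trans (Perm.punchIn-permute ρ Fin.zero k)
      (cong (λ i → Fin.punchIn i (remove Fin.zero ρ ⟨$⟩ʳ k)) (≡.sym (p Fin.zero))))))

-- The dihedral group of order 2n acts on the residues modulo n by affine maps.
module Affine (n : ℕ) .{{_ : NonZero n}} where
  open Mod n
  private
    module Dₙ = Group (D n)
    module Cₙ = Inverse (proj₂ (C-finite n))

  act : Dₙ.Carrier → Fin n → Fin n
  act (i , s) x = Cₙ.to (i ℤ.+ s · Cₙ.from x)

  act-cong : ∀ {g h} → g Dₙ.≈ h → ∀ x → act g x ≡ act h x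
  act-cong {i , s} {j , .s} (p , ≡.refl) x =
    Cₙ.to-cong {i ℤ.+ s · Cₙ.from x} {j ℤ.+ s · Cₙ.from x}
      (+-cong {i} {j} {s · Cₙ.from x} {s · Cₙ.from x} p (≡⇒ {s · Cₙ.from x} ≡.refl))

  act-∙ : ∀ g h x → act (g Dₙ.∙ h) x ≡ act g (act h x)
  act-∙ g@(i , s) h@(j , t) x = Cₙ.to-cong {proj₁ ((g Dₙ.∙ h) Dₙ.∙ y)} {proj₁ (g Dₙ.∙ z)}
    (proj₁ (Dₙ.trans {(g Dₙ.∙ h) Dₙ.∙ y} {g Dₙ.∙ (h Dₙ.∙ y)} {g Dₙ.∙ z} (Dₙ.assoc g h y)
      (Dₙ.∙-congˡ {g} {h Dₙ.∙ y} {z}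
        (mod-sym {Cₙ.from (act h x)} {j ℤ.+ t · Cₙ.from x}
          (Cₙ.strictlyInverseʳ (j ℤ.+ t · Cₙ.from x))
        , ≡.refl))))
    where
    y z : Dₙ.Carrier
    y = Cₙ.from x , Sign.+
    z = Cₙ.from (act h x) , t Sign.* Sign.+

  act-ε : ∀ x → act Dₙ.ε x ≡ x
  act-ε x = ≡.trans (cong Cₙ.to (ℤₚ.+-identityˡ (Cₙ.from x))) (Cₙ.strictlyInverseˡ x)

  affine : Dₙ.Carrier → Permutation′ n
  affine g = permutation (act g) (act (g Dₙ.⁻¹))
    (λ x → ≡.trans (≡.sym (act-∙ g (g Dₙ.⁻¹) x))
             (≡.trans (act-cong {g Dₙ.∙ g Dₙ.⁻¹} {Dₙ.ε} (Dₙ.inverseʳ g) x) (act-ε x)))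
    (λ x → ≡.trans (≡.sym (act-∙ (g Dₙ.⁻¹) g x))
             (≡.trans (act-cong {g Dₙ.⁻¹ Dₙ.∙ g} {Dₙ.ε} (Dₙ.inverseˡ g) x) (act-ε x)))

  fixed : ∀ i s j → act (i , s) (Cₙ.to j) ≡ Cₙ.to j → i ℤ.+ s · j ≡ j [mod n ]
  fixed i s j eq = begin
    i ℤ.+ s · j                ≈⟨ proj₁ (Dₙ.∙-congˡ {i , s} {j , Sign.+} {j′ , Sign.+}
                                    (mod-sym {j′} {j} (Cₙ.strictlyInverseʳ j) , ≡.refl)) ⟩
    i ℤ.+ s · j′               ≈⟨ Cₙ.strictlyInverseʳ (i ℤ.+ s · j′) ⟨
    Cₙ.from (act (i , s) (Cₙ.to j))  ≡⟨ cong Cₙ.from eq ⟩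
    j′                         ≈⟨ Cₙ.strictlyInverseʳ j ⟩
    j                          ∎
    where
    open SetoidReasoning (Group.setoid (C n))
    j′ : ℤ
    j′ = Cₙ.from (Cₙ.to j)

  -- For n > 2 the action is faithful already on the residues 0 and 1.
  affine-Emb : 2 < n → Emb (D n) (Sym n)
  affine-Emb 2<n = embedding (D n) (Sym n) affine
    (λ {g} {h} g≈h → act-cong {g} {h} g≈h)
    act-∙
    (λ { (i , s) p → kernel i s (fixed i s (+ 0) (p _)) (fixed i s (+ 1) (p _)) })
    where
    translation : ∀ i → (i ℤ.+ + 0) ℤ.- + 0 ≡ i ℤ.- + 0
    translation = ℤ-Solver.solve-∀
    difference : ∀ i → ((i ℤ.+ + 0) ℤ.- + 0) ℤ.- ((i ℤ.+ (ℤ.- + 1)) ℤ.- + 1) ≡ + 2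
    difference = ℤ-Solver.solve-∀
    kernel : ∀ i s → i ℤ.+ s · + 0 ≡ + 0 [mod n ] → i ℤ.+ s · + 1 ≡ + 1 [mod n ] →
             (i , s) Dₙ.≈ Dₙ.ε
    kernel i Sign.+ p _ = ≡.subst (+ n ℤ∣.∣_) (translation i) p , ≡.refl
    kernel i Sign.- p q = contradiction
      (∣⇒∣ᵤ (≡.subst (+ n ℤ∣.∣_) (difference i) (ℤ∣.∣m∣n⇒∣m-n p q))) (ℕ∣.>⇒∤ 2<n)

lift₀-Emb : ∀ m → Emb (Sym m) (Sym (suc m))
lift₀-Emb m = embedding (Sym m) (Sym (suc m)) lift₀
  (λ {π} {ρ} → lift₀-cong π ρ)
  (λ π ρ i → ≡.sym (lift₀-comp ρ π i))
  (λ π p i → Finₚ.suc-injective (p (Fin.suc i)))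

Sym-Emb : ∀ k → Emb (D 3) (Sym (k + 3))
Sym-Emb zero    = Affine.affine-Emb 3 ℕₚ.≤-refl
Sym-Emb (suc k) = lift₀-Emb (k + 3) ∘ₑ Sym-Emb k

corollary4p4 : (H : Grp) → IsHallUniversal H →
    ((G : Grp) → IsFinite G → (∃[ m ] (1 ≤ m × D (2 * m) ≲ G)) → T[ G , H ]≡∞)
    ×
    ((G : Grp) → IsFinite G → C 2 ×ᴳ C 2 ≲ G → T[ G , H ]≡∞)
    ×
    ((k : ℕ) (ns : Vec ℕ k) (A : Grp) → ((i : Fin k) → 1 ≤ lookup ns i) → A ≅ ∏C ns →
    (∃[ i ] ∃[ j ] (i ≢ j × 2 ∣ lookup ns i × 2 ∣ lookup ns j)) → T[ A , H ]≡∞)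
    ×
    ((n : ℕ) → 3 ≤ n → T[ Sym n , H ]≡∞)
corollary4p4 H hall =
    (λ { G G-finite (m , 1≤m , D≲G) →
         contains-D⇒T≡∞ hall G-finite (ℕₚ.*-monoʳ-≤ 2 1≤m) (≲⇒Emb D≲G) })
  , (λ G G-finite C₂²≲G →
         contains-D⇒T≡∞ hall G-finite ℕₚ.≤-refl (≲⇒Emb C₂²≲G ∘ₑ C₂²-Emb))
  , (λ { k ns A 1≤ns A≅∏C (i , j , i≢j , 2∣nᵢ , 2∣nⱼ) →
         contains-D⇒T≡∞ hall (Finite-≅ (≅⇒Inverse A≅∏C) (∏C-finite ns 1≤ns)) ℕₚ.≤-refl
           (≅⇒Emb⁻¹ A≅∏C ∘ₑ (∏C-Emb ns 1≤ns i≢j 2∣nᵢ 2∣nⱼ ∘ₑ C₂²-Emb)) })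
  , (λ n 3≤n → contains-D⇒T≡∞ hall (Sym-finite n) (s≤s (s≤s z≤n))
         (≡.subst (λ n → Emb (D 3) (Sym n)) (ℕₚ.m∸n+n≡m 3≤n) (Sym-Emb (n ℕ.∸ 3))))
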